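{- Let $n,k$ be positive integers with $n>36k$ and let $\mathcal F\subset\binom{[n]}{k}$ be an intersecting family. Then \[ \gamma(\mathcal F)\le \binom{n-3}{k-2}. \]
   Context: $[n]=\{1,\dots,n\}$ and $\binom{[n]}{k}$ is the set of $k$-element subsets of $[n]$. A family $\mathcal F$ is intersecting if $F\cap F'\neq\emptyset$ for all $F,F'\in\mathcal F$. For $i\in[n]$ let $\mathcal F(\bar i)=\{F\in\mathcal F: i\notin F\}$. The diversity of $\mathcal F$ is $\gamma(\mathcal F)=\min_{i\in[n]}|\mathcal F(\bar i)|$, i.e. the minimum number of sets whose deletion leaves a family with nonempty common intersection. Binomial coefficients $\binom{m}{j}$ are $0$ when $j<0$ or $j>m$. -}

module Defs where

open import Data.Nat using (ℕ; zero; suc; _∸_; _⊓_)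
open import Data.Nat.Combinatorics using (_C_)
open import Data.Fin using (Fin)
open import Data.Fin.Subset using (Subset; _∈_; _∉_; _∩_; Nonempty; ∣_∣)
open import Data.Fin.Subset.Properties using (_∈?_)
open import Data.List using (List; []; _∷_; length; filter; map; foldr)
open import Data.List.Membership.Propositional renaming (_∈_ to _∈ₗ_)
open import Data.List.Relation.Unary.All using (All)
open import Data.List.Relation.Unary.Unique.Propositional using (Unique)
open import Data.Vec using (Vec; allFin; toList)
open import Relation.Nullary.Decidable using (¬?)
open import Relation.Binary.PropositionalEquality using (_≡_)

record Family (n : ℕ) : Set where
  constructor family
  field
    sets   : List (Subset n)
    unique : Unique sets
open Family public

Uniform : ∀ {n} → ℕ → Family n → Set
Uniform k F = All (λ A → ∣ A ∣ ≡ k) (sets F)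

Intersecting : ∀ {n} → Family n → Set
Intersecting F = ∀ {A B} → A ∈ₗ sets F → B ∈ₗ sets F → Nonempty (A ∩ B)

avoidCount : ∀ {n} → Family n → Fin n → ℕ
avoidCount F i = length (filter (λ A → ¬? (i ∈? A)) (sets F))

-- diversity γ(F) = min_{i ∈ [n]} |F(ī)|  (a minimum over a nonempty index set
-- whenever n ≥ 1; for n = 0 it is set to 0, a case excluded by the hypotheses)
minList : List ℕ → ℕ
minList []       = 0
minList (x ∷ xs) = foldr _⊓_ x xs

diversity : ∀ {n} → Family n → ℕ
diversity {n} F = minList (map (avoidCount F) (toList (allFin n)))

-- binomPred m j = binom(m, j - 1), with binom(m, -1) = 0
binomPred : ℕ → ℕ → ℕ
binomPred m zero    = 0
binomPred m (suc j) = m C j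

{-# OPTIONS --safe #-}
-- Write N = C(n−3, k−2) and D = C(n−3, k−3), so that 35 D ≤ N, and suppose that for every
-- element more than N members of F avoid it.
--
-- If more than D members avoid both x and y, Kruskal–Katona bounds the codegree of x, y by 3D.
-- Were all codegrees at most 3D, we could shift F towards a single element e, replacing z by e
-- for one z at a time. A step at most doubles the degree bound of e, so that the codegree bounds
-- survive, and either an element becomes popular or the shift is completed. A completed shift
-- makes the sets avoiding e intersect in one element more, and t-intersecting families on
-- n−3 points have at most C(n−3, k−t) members. This yields first one popular element x, then
-- a second one y, and finally a contradiction: the sets containing exactly one of x, y would
-- after one more shift be cross 2-intersecting, so that at most D of one kind remain.
--
-- Hence some x, y have codegree above 3D and almost all sets meet {x, y}. The same shifting
-- argument for the sets containing exactly one of x, y finds a third element z such that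
-- F is close to the family of sets meeting {x, y, z} at least twice. For sets P with trace of
-- size 2 and Q with the complementary or empty trace, Kruskal–Katona gives |P| + 3 |Q| ≤ N,
-- and summing these inequalities contradicts the assumption.

module Submission where

open import Defs
open import Data.Nat using (ℕ; _∸_; _*_; _<_; _≤_)
open import Data.Bool using (Bool; true; false; _∧_; _∨_; not; if_then_else_; T)
open import Data.Bool.Properties using (∧-comm; ∧-assoc; ∨-idem; ∧-idem; ∧-identityʳ; ∧-zeroʳ) renaming (_≟_ to _≟ᵇ_)
open import Data.Empty using (⊥; ⊥-elim)
open import Data.Fin using (Fin; zero; suc; punchOut; fromℕ<)
open import Data.Fin.Properties using (any?; punchIn-punchOut; punchOut-injective) renaming (_≟_ to _≟ᶠ_)
open import Data.Fin.Subset using (∣_∣)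
open import Data.Fin.Subset.Properties renaming (_∈?_ to _∈ᵥ?_) using ()
open import Data.List using (List; []; _∷_; allFin; filter; foldr; length)
open import Data.List.Membership.Propositional using (_∈_)
open import Data.List.Membership.Propositional.Properties using (∈-allFin; ∈-filter⁺; ∈-filter⁻; ∈-map⁺)
import Data.List.Membership.DecPropositional as DecMembership
open import Data.List.Relation.Unary.All as All using (All; []; _∷_)
open import Data.List.Relation.Unary.AllPairs using ([]; _∷_)
open import Data.List.Relation.Unary.Any using (here; there)
open import Data.List.Relation.Unary.Unique.Propositional using (Unique)
open import Data.List.Relation.Unary.Unique.Propositional.Properties using (filter⁺)
open import Data.Nat using (zero; suc; _+_; _⊓_; z≤n; s≤s; _≤?_; _<?_; _≡ᵇ_)
open import Data.Nat.Combinatorics using (_C_; nCk+nC[k+1]≡[n+1]C[k+1]; nCk≡nC[n∸k]; nCn≡1)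
open import Data.Nat.Properties
open import Data.Nat.Tactic.RingSolver using (solve-∀)
open import Data.Product using (∃; _×_; _,_; proj₁; proj₂)
open import Data.Sum using (_⊎_; inj₁; inj₂)
open import Data.Vec using (Vec; []; _∷_; lookup; _[_]≔_; zipWith; insertAt; map)
open import Data.Vec.Membership.Propositional.Properties using (∈-toList⁺; ∈-allFin⁺)
open import Data.Vec.Properties using (≡-dec; lookup∘update; lookup∘update′; []≔-idempotent; []≔-lookup; insertAt-lookup; insertAt-punchIn; []=⇒lookup; lookup⇒[]=)
open import Function using (_∘_)
open import Relation.Binary.PropositionalEquality
open import Relation.Nullary using (Dec; yes; no; ¬_)
open import Relation.Nullary.Decidable using (from-yes; ⌊_⌋; ¬?; _×-dec_; _⊎-dec_)

-- Families as Boolean functions on the cube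

private variable
  n m k t : ℕ

-- With families as indicator functions, shifts and restrictions become pointwise Boolean formulas,
-- and sizes can be compared point by point.
Fam : ℕ → Set
Fam n = Vec Bool n → Bool

bit : Bool → ℕ
bit true  = 1
bit false = 0

-- Pointwise inequalities between sizes are settled by truth tables, evaluated through `from-yes`.
∀𝔹? : {P : Bool → Set} → (∀ b → Dec (P b)) → Dec (∀ b → P b)
∀𝔹? P? with P? true | P? false
... | yes p | yes q = yes λ { true → p ; false → q }
... | no ¬p | _     = no λ p → ¬p (p true)
... | yes _ | no ¬q = no λ q → ¬q (q false)

-- Recursion on the first coordinate makes the split of a family by its first element hold by
-- definition; the inductions on the ground set rest on this.
∑ : (Vec Bool n → ℕ) → ℕ
∑ {zero}  f = f []
∑ {suc n} f = ∑ (λ v → f (true ∷ v)) + ∑ (λ v → f (false ∷ v))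

∑-cong : {f g : Vec Bool n → ℕ} → (∀ v → f v ≡ g v) → ∑ f ≡ ∑ g
∑-cong {zero}  p = p []
∑-cong {suc n} p = cong₂ _+_ (∑-cong (p ∘ (true ∷_))) (∑-cong (p ∘ (false ∷_)))

∑-mono : {f g : Vec Bool n → ℕ} → (∀ v → f v ≤ g v) → ∑ f ≤ ∑ g
∑-mono {zero}  p = p []
∑-mono {suc n} p = +-mono-≤ (∑-mono (p ∘ (true ∷_))) (∑-mono (p ∘ (false ∷_)))

interchange : ∀ a b c d → (a + b) + (c + d) ≡ (a + c) + (b + d)
interchange = solve-∀

comm₃ : ∀ a b c → a + (b + c) ≡ b + (a + c)
comm₃ = solve-∀

∑-+ : (f g : Vec Bool n → ℕ) → ∑ (λ v → f v + g v) ≡ ∑ f + ∑ g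
∑-+ {zero}  f g = refl
∑-+ {suc n} f g =
  trans (cong₂ _+_ (∑-+ (f ∘ (true ∷_)) (g ∘ (true ∷_))) (∑-+ (f ∘ (false ∷_)) (g ∘ (false ∷_))))
        (interchange (∑ (f ∘ (true ∷_))) _ _ _)

∑-≡0 : {f : Vec Bool n → ℕ} → (∀ v → f v ≡ 0) → ∑ f ≡ 0
∑-≡0 {zero}  p = p []
∑-≡0 {suc n} p = cong₂ _+_ (∑-≡0 (p ∘ (true ∷_))) (∑-≡0 (p ∘ (false ∷_)))

# : Fam n → ℕ
# G = ∑ (bit ∘ G)

infixl 7 _∩_
_∩_ : Fam n → Fam n → Fam n
(G ∩ H) v = G v ∧ H v

#-cong : {G H : Fam n} → (∀ v → G v ≡ H v) → # G ≡ # H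
#-cong p = ∑-cong λ v → cong bit (p v)

#-≤1 : {G H : Fam n} → (∀ v → bit (G v) ≤ bit (H v)) → # G ≤ # H
#-≤1 = ∑-mono

#-≤2 : (G H K : Fam n) → (∀ v → bit (G v) ≤ bit (H v) + bit (K v)) → # G ≤ # H + # K
#-≤2 G H K p = ≤-trans (∑-mono p) (≤-reflexive (∑-+ (bit ∘ H) (bit ∘ K)))

#-≤3 : (G H K L : Fam n) → (∀ v → bit (G v) ≤ bit (H v) + bit (K v) + bit (L v)) →
       # G ≤ # H + # K + # L
#-≤3 G H K L p = ≤-trans (∑-mono p) (≤-reflexive
  (trans (∑-+ (λ v → bit (H v) + bit (K v)) (bit ∘ L)) (cong (_+ # L) (∑-+ (bit ∘ H) (bit ∘ K)))))

#-≤4 : (G H K L M : Fam n) → (∀ v → bit (G v) ≤ bit (H v) + bit (K v) + bit (L v) + bit (M v)) →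
       # G ≤ # H + # K + # L + # M
#-≤4 G H K L M p = ≤-trans (∑-mono p) (≤-reflexive
  (trans (∑-+ (λ v → bit (H v) + bit (K v) + bit (L v)) (bit ∘ M)) (cong (_+ # M)
  (trans (∑-+ (λ v → bit (H v) + bit (K v)) (bit ∘ L)) (cong (_+ # L) (∑-+ (bit ∘ H) (bit ∘ K)))))))

#-empty : {G : Fam n} → (∀ v → G v ≡ true → ⊥) → # G ≡ 0
#-empty {G = G} p = ∑-≡0 λ v → aux v (G v) refl
  where
  aux : ∀ v b → G v ≡ b → bit b ≡ 0
  aux v true  e = ⊥-elim (p v e)
  aux v false e = refl

#-member : (G : Fam n) → # G ≡ 0 ⊎ ∃ λ v → G v ≡ true
#-member {zero} G with G [] in e
... | true  = inj₂ ([] , e)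
... | false = inj₁ refl
#-member {suc n} G with #-member (G ∘ (true ∷_)) | #-member (G ∘ (false ∷_))
... | inj₂ (v , p) | _            = inj₂ (true ∷ v , p)
... | inj₁ _       | inj₂ (v , p) = inj₂ (false ∷ v , p)
... | inj₁ p       | inj₁ q       = inj₁ (cong₂ _+_ p q)

-- Sizes of sets and of their intersections

wt : Vec Bool n → ℕ
wt []      = 0
wt (b ∷ v) = bit b + wt v

infixl 7 _⋒_
_⋒_ : Vec Bool n → Vec Bool n → Vec Bool n
_⋒_ = zipWith _∧_

wt-⋒ˡ : (v w : Vec Bool n) → wt (v ⋒ w) ≤ wt v
wt-⋒ˡ []      []      = z≤n
wt-⋒ˡ (b ∷ v) (c ∷ w) = +-mono-≤ (bit-∧ b c) (wt-⋒ˡ v w)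
  where
  bit-∧ : ∀ b c → bit (b ∧ c) ≤ bit b
  bit-∧ = from-yes (∀𝔹? λ b → ∀𝔹? λ c → bit (b ∧ c) ≤? bit b)

⋒-comm : (v w : Vec Bool n) → v ⋒ w ≡ w ⋒ v
⋒-comm []      []      = refl
⋒-comm (b ∷ v) (c ∷ w) = cong₂ _∷_ (∧-comm b c) (⋒-comm v w)

wt-⋒ʳ : (v w : Vec Bool n) → wt (v ⋒ w) ≤ wt w
wt-⋒ʳ v w = subst (λ u → wt u ≤ wt w) (⋒-comm w v) (wt-⋒ˡ w v)

Unif : ℕ → Fam n → Set
Unif k G = ∀ v → G v ≡ true → wt v ≡ k

Cross : ℕ → Fam n → Fam n → Set
Cross t A B = ∀ v w → A v ≡ true → B w ≡ true → t ≤ wt (v ⋒ w)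

-- Exchanging two elements

swap : Fin n → Fin n → Vec Bool n → Vec Bool n
swap e z v = (v [ e ]≔ lookup v z) [ z ]≔ lookup v e

≔-same : (v : Vec Bool n) (i : Fin n) {b : Bool} → lookup v i ≡ b → v [ i ]≔ b ≡ v
≔-same v i refl = []≔-lookup v i

swap-same : (e z : Fin n) (v : Vec Bool n) → lookup v e ≡ lookup v z → swap e z v ≡ v
swap-same e z v p rewrite sym p | []≔-lookup v e = ≔-same v z (sym p)

lookup-swap-z : (e z : Fin n) (v : Vec Bool n) → lookup (swap e z v) z ≡ lookup v e
lookup-swap-z e z v = lookup∘update z (v [ e ]≔ lookup v z) (lookup v e)

lookup-swap-e : (e z : Fin n) (v : Vec Bool n) → lookup (swap e z v) e ≡ lookup v z
lookup-swap-e e z v with e ≟ᶠ z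
... | yes refl = lookup-swap-z e e v
... | no e≢z   = trans (lookup∘update′ e≢z (v [ e ]≔ lookup v z) (lookup v e)) (lookup∘update e v (lookup v z))

lookup-swap-≢ : {e z i : Fin n} → i ≢ e → i ≢ z → (v : Vec Bool n) → lookup (swap e z v) i ≡ lookup v i
lookup-swap-≢ {e = e} {z} i≢e i≢z v =
  trans (lookup∘update′ i≢z (v [ e ]≔ lookup v z) (lookup v e)) (lookup∘update′ i≢e v (lookup v z))

swap-involutive : (e z : Fin n) (v : Vec Bool n) → swap e z (swap e z v) ≡ v
swap-involutive zero    zero    (b ∷ v) = refl
swap-involutive zero    (suc z) (b ∷ v) = cong₂ _∷_ (lookup∘update z v b)
  (trans ([]≔-idempotent v z) ([]≔-lookup v z))
swap-involutive (suc e) zero    (b ∷ v) = cong₂ _∷_ (lookup∘update e v b)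
  (trans ([]≔-idempotent v e) ([]≔-lookup v e))
swap-involutive (suc e) (suc z) (b ∷ v) = cong (b ∷_) (swap-involutive e z v)

-- The case of `∑-swap` in which the first element is exchanged with a later one. In the induction
-- the second coordinate stays put while the first is exchanged with one further on.
∑-exchange : (z : Fin n) (f : Vec Bool (suc n) → ℕ) →
  ∑ (λ v → f (lookup v z ∷ v [ z ]≔ true)) + ∑ (λ v → f (lookup v z ∷ v [ z ]≔ false)) ≡ ∑ f
∑-exchange zero    f = interchange (∑ λ v → f (true ∷ true ∷ v)) _ _ _
∑-exchange (suc z) f = begin
    (p true true + p true false) + (p false true + p false false)
  ≡⟨ interchange (p true true) _ _ _ ⟩
    (p true true + p false true) + (p true false + p false false)
  ≡⟨ cong₂ _+_ (∑-exchange z λ { (b ∷ v) → f (b ∷ true ∷ v) }) (∑-exchange z λ { (b ∷ v) → f (b ∷ false ∷ v) }) ⟩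
    (q true true + q false true) + (q true false + q false false)
  ≡⟨ interchange (q true true) _ _ _ ⟩
    (q true true + q true false) + (q false true + q false false) ∎
  where
  open ≡-Reasoning
  p q : Bool → Bool → ℕ
  p b c = ∑ λ v → f (lookup v z ∷ c ∷ v [ z ]≔ b)
  q b c = ∑ λ v → f (b ∷ c ∷ v)

∑-swap : (e z : Fin n) (f : Vec Bool n → ℕ) → ∑ (f ∘ swap e z) ≡ ∑ f
∑-swap zero    zero    f = refl
∑-swap zero    (suc z) f = ∑-exchange z f
∑-swap (suc e) zero    f = ∑-exchange e f
∑-swap (suc e) (suc z) f = cong₂ _+_ (∑-swap e z (f ∘ (true ∷_))) (∑-swap e z (f ∘ (false ∷_)))

wt-exchange : (z : Fin n) (b : Bool) (v : Vec Bool n) → bit (lookup v z) + wt (v [ z ]≔ b) ≡ bit b + wt v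
wt-exchange zero    b (c ∷ v) = comm₃ (bit c) (bit b) (wt v)
wt-exchange (suc z) b (c ∷ v) = begin
    bit (lookup v z) + (bit c + wt (v [ z ]≔ b))
  ≡⟨ comm₃ (bit (lookup v z)) (bit c) _ ⟩
    bit c + (bit (lookup v z) + wt (v [ z ]≔ b))
  ≡⟨ cong (bit c +_) (wt-exchange z b v) ⟩
    bit c + (bit b + wt v)
  ≡⟨ comm₃ (bit c) (bit b) _ ⟩
    bit b + (bit c + wt v) ∎
  where open ≡-Reasoning

wt-swap : (e z : Fin n) (v : Vec Bool n) → wt (swap e z v) ≡ wt v
wt-swap zero    zero    (b ∷ v) = refl
wt-swap zero    (suc z) (b ∷ v) = wt-exchange z b v
wt-swap (suc e) zero    (b ∷ v) = wt-exchange e b v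
wt-swap (suc e) (suc z) (b ∷ v) = cong (bit b +_) (wt-swap e z v)

⋒-≔ : (z : Fin n) (b c : Bool) (v w : Vec Bool n) → (v [ z ]≔ b) ⋒ (w [ z ]≔ c) ≡ (v ⋒ w) [ z ]≔ (b ∧ c)
⋒-≔ zero    b c (_ ∷ v) (_ ∷ w) = refl
⋒-≔ (suc z) b c (x ∷ v) (y ∷ w) = cong (x ∧ y ∷_) (⋒-≔ z b c v w)

lookup-⋒ : (z : Fin n) (v w : Vec Bool n) → lookup (v ⋒ w) z ≡ lookup v z ∧ lookup w z
lookup-⋒ zero    (_ ∷ v) (_ ∷ w) = refl
lookup-⋒ (suc z) (_ ∷ v) (_ ∷ w) = lookup-⋒ z v w

swap-⋒ : (e z : Fin n) (v w : Vec Bool n) → swap e z v ⋒ swap e z w ≡ swap e z (v ⋒ w)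
swap-⋒ e z v w rewrite ⋒-≔ z (lookup v e) (lookup w e) (v [ e ]≔ lookup v z) (w [ e ]≔ lookup w z)
  | ⋒-≔ e (lookup v z) (lookup w z) v w | lookup-⋒ e v w | lookup-⋒ z v w = refl

wt-swap-⋒ : (e z : Fin n) (v w : Vec Bool n) → wt (swap e z v ⋒ swap e z w) ≡ wt (v ⋒ w)
wt-swap-⋒ e z v w = trans (cong wt (swap-⋒ e z v w)) (wt-swap e z (v ⋒ w))

wt-⋒-≔ : (z : Fin n) (b : Bool) (v w : Vec Bool n) →
  bit (lookup v z ∧ lookup w z) + wt (v ⋒ (w [ z ]≔ b)) ≡ bit (lookup v z ∧ b) + wt (v ⋒ w)
wt-⋒-≔ z b v w = begin
    bit (lookup v z ∧ lookup w z) + wt (v ⋒ (w [ z ]≔ b))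
  ≡⟨ cong (λ u → bit (lookup v z ∧ lookup w z) + wt (u ⋒ (w [ z ]≔ b))) (sym ([]≔-lookup v z)) ⟩
    bit (lookup v z ∧ lookup w z) + wt ((v [ z ]≔ lookup v z) ⋒ (w [ z ]≔ b))
  ≡⟨ cong₂ (λ x u → bit x + wt u) (sym (lookup-⋒ z v w)) (⋒-≔ z (lookup v z) b v w) ⟩
    bit (lookup (v ⋒ w) z) + wt ((v ⋒ w) [ z ]≔ (lookup v z ∧ b))
  ≡⟨ wt-exchange z (lookup v z ∧ b) (v ⋒ w) ⟩
    bit (lookup v z ∧ b) + wt (v ⋒ w) ∎
  where open ≡-Reasoning

-- Only the positions `e` and `z` can change. Their old contributions are added to the new weight
-- and their new ones to the old weight, which avoids subtraction.
wt-⋒-swap : {e z : Fin n} → e ≢ z → (v w : Vec Bool n) →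
  (bit (lookup v z ∧ lookup w z) + bit (lookup v e ∧ lookup w e)) + wt (v ⋒ swap e z w) ≡
  (bit (lookup v z ∧ lookup w e) + bit (lookup v e ∧ lookup w z)) + wt (v ⋒ w)
wt-⋒-swap {e = e} {z} e≢z v w = begin
    (a + b) + wt (v ⋒ swap e z w)
  ≡⟨ assoc₁ a b _ ⟩
    b + (a + wt (v ⋒ swap e z w))
  ≡⟨ cong (λ x → b + (bit (lookup v z ∧ x) + wt (v ⋒ swap e z w)))
       (sym (lookup∘update′ (e≢z ∘ sym) w (lookup w z))) ⟩
    b + (bit (lookup v z ∧ lookup (w [ e ]≔ lookup w z) z) + wt (v ⋒ swap e z w))
  ≡⟨ cong (b +_) (wt-⋒-≔ z (lookup w e) v (w [ e ]≔ lookup w z)) ⟩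
    b + (c + wt (v ⋒ (w [ e ]≔ lookup w z)))
  ≡⟨ comm₃ b c _ ⟩
    c + (b + wt (v ⋒ (w [ e ]≔ lookup w z)))
  ≡⟨ cong (c +_) (wt-⋒-≔ e (lookup w z) v w) ⟩
    c + (d + wt (v ⋒ w))
  ≡⟨ sym (+-assoc c d _) ⟩
    (c + d) + wt (v ⋒ w) ∎
  where
  open ≡-Reasoning
  a = bit (lookup v z ∧ lookup w z)
  b = bit (lookup v e ∧ lookup w e)
  c = bit (lookup v z ∧ lookup w e)
  d = bit (lookup v e ∧ lookup w z)
  assoc₁ : ∀ x y z → (x + y) + z ≡ y + (x + z)
  assoc₁ = solve-∀

-- If `w` also contains `z`, the swap does nothing; otherwise it trades the common element `e` for
-- `z`, which is common at best.
wt-⋒-swap-≤ : (e z : Fin n) (v w : Vec Bool n) → lookup v e ≡ true → lookup w e ≡ true →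
  wt (v ⋒ swap e z w) ≤ wt (v ⋒ w)
wt-⋒-swap-≤ e z v w p q with e ≟ᶠ z
... | yes refl = ≤-reflexive (cong (wt ∘ (v ⋒_)) (swap-same e e w refl))
... | no e≢z with wt-⋒-swap e≢z v w
... | eq rewrite p | q = +-cancelˡ-≤ _ _ _ (≤-trans (≤-reflexive eq)
        (+-monoˡ-≤ (wt (v ⋒ w)) (bits (lookup v z) (lookup w z))))
  where
  bits : ∀ x y → bit (x ∧ true) + bit y ≤ bit (x ∧ y) + 1
  bits = from-yes (∀𝔹? λ x → ∀𝔹? λ y → bit (x ∧ true) + bit y ≤? bit (x ∧ y) + 1)

-- The shift of a family

false≢true : false ≢ true
false≢true ()

-- The classical shift replacing `z` by `e`. Of two sets exchanged by `swap e z`, a lone member is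
-- moved to the one containing `e`; a set containing both or neither of `e` and `z` is its own swap
-- and keeps its status.
S : Fin n → Fin n → Fam n → Fam n
S e z G v = if lookup v e then G v ∨ G (swap e z v) else G v ∧ G (swap e z v)

∨-true : ∀ {x y} → x ∨ y ≡ true → x ≡ true ⊎ y ≡ true
∨-true {true}  p = inj₁ refl
∨-true {false} p = inj₂ p

∧-exchange : ∀ x y z → (x ∧ y) ∧ z ≡ (x ∧ z) ∧ y
∧-exchange true  y z = ∧-comm y z
∧-exchange false y z = refl

∧-true : ∀ {x y} → x ∧ y ≡ true → x ≡ true × y ≡ true
∧-true {true} p = refl , p

S-∋ : (e z : Fin n) (G : Fam n) (v : Vec Bool n) → S e z G v ≡ true →
  (lookup v e ≡ true × (G v ≡ true ⊎ G (swap e z v) ≡ true)) ⊎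
  (lookup v e ≡ false × G v ≡ true × G (swap e z v) ≡ true)
S-∋ e z G v p with lookup v e
... | true  = inj₁ (refl , ∨-true p)
... | false = inj₂ (refl , ∧-true p)

∋-S-true : (e z : Fin n) (G : Fam n) (v : Vec Bool n) → lookup v e ≡ true → G v ≡ true → S e z G v ≡ true
∋-S-true e z G v p q rewrite p | q = refl

∋-S-same : (e z : Fin n) (G : Fam n) (v : Vec Bool n) → lookup v e ≡ lookup v z → G v ≡ true → S e z G v ≡ true
∋-S-same e z G v p q rewrite swap-same e z v p | q with lookup v e
... | true  = refl
... | false = refl

-- The swap permutes the cube, so twice a sum is the sum of the totals over `v` and `swap e z v`,
-- and it suffices to compare these totals.
∑-double : (f g : Vec Bool n → ℕ) (e z : Fin n) →
  (∀ v → f v + f (swap e z v) ≡ g v + g (swap e z v)) → ∑ f ≡ ∑ g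
∑-double f g e z p = *-cancelˡ-≡ (∑ f) (∑ g) 2 (begin
    2 * ∑ f                        ≡⟨ double (∑ f) ⟩
    ∑ f + ∑ f                      ≡⟨ cong (∑ f +_) (sym (∑-swap e z f)) ⟩
    ∑ f + ∑ (f ∘ swap e z)         ≡⟨ sym (∑-+ f (f ∘ swap e z)) ⟩
    ∑ (λ v → f v + f (swap e z v)) ≡⟨ ∑-cong p ⟩
    ∑ (λ v → g v + g (swap e z v)) ≡⟨ ∑-+ g (g ∘ swap e z) ⟩
    ∑ g + ∑ (g ∘ swap e z)         ≡⟨ cong (∑ g +_) (∑-swap e z g) ⟩
    ∑ g + ∑ g                      ≡⟨ sym (double (∑ g)) ⟩
    2 * ∑ g ∎)
  where
  open ≡-Reasoning
  double : ∀ x → 2 * x ≡ x + x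
  double = solve-∀

S-# : (e z : Fin n) (G : Fam n) → # (S e z G) ≡ # G
S-# e z G = ∑-double (bit ∘ S e z G) (bit ∘ G) e z pointwise
  where
  pair : ∀ b c x y → (b ≡ c → x ≡ y) →
    bit (if b then x ∨ y else x ∧ y) + bit (if c then y ∨ x else y ∧ x) ≡ bit x + bit y
  pair true  true  x     y     p rewrite p refl | ∨-idem y = refl
  pair false false x     y     p rewrite p refl | ∧-idem y = refl
  pair true  false true  true  _ = refl
  pair true  false true  false _ = refl
  pair true  false false true  _ = refl
  pair true  false false false _ = refl
  pair false true  true  true  _ = refl
  pair false true  true  false _ = refl
  pair false true  false true  _ = refl
  pair false true  false false _ = refl
  pointwise : ∀ v → bit (S e z G v) + bit (S e z G (swap e z v)) ≡ bit (G v) + bit (G (swap e z v))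
  pointwise v = trans
    (cong₂ (λ c u → bit (S e z G v) + bit (if c then G (swap e z v) ∨ G u else G (swap e z v) ∧ G u))
      (lookup-swap-e e z v) (swap-involutive e z v))
    (pair (lookup v e) (lookup v z) (G v) (G (swap e z v)) λ p → cong G (sym (swap-same e z v p)))

S-Unif : (e z : Fin n) {G : Fam n} → Unif k G → Unif k (S e z G)
S-Unif e z {G} u v p with S-∋ e z G v p
... | inj₁ (_ , inj₁ q) = u v q
... | inj₁ (_ , inj₂ q) = trans (sym (wt-swap e z v)) (u (swap e z v) q)
... | inj₂ (_ , q , _)  = u v q

-- A shifted member avoiding `e` has both itself and its swap in the original family, so it can be
-- matched with whichever witness the other set has. A mismatch is left only if both sets contain
-- `e`, and there `wt-⋒-swap-≤` applies.
S-Cross : (e z : Fin n) {A B : Fam n} → Cross t A B → Cross t (S e z A) (S e z B)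
S-Cross {t = t} e z {A} {B} c v w p q with S-∋ e z A v p | S-∋ e z B w q
... | inj₁ (_ , inj₁ a)  | inj₁ (_ , inj₁ b)  = c v w a b
... | inj₁ (i , inj₁ a)  | inj₁ (j , inj₂ b)  = ≤-trans (c v _ a b) (wt-⋒-swap-≤ e z v w i j)
... | inj₁ (i , inj₂ a)  | inj₁ (j , inj₁ b)  = ≤-trans (c _ w a b)
      (≤-trans (≤-reflexive (cong wt (⋒-comm (swap e z v) w)))
      (≤-trans (wt-⋒-swap-≤ e z w v j i) (≤-reflexive (cong wt (⋒-comm w v)))))
... | inj₁ (_ , inj₂ a)  | inj₁ (_ , inj₂ b)  = ≤-trans (c _ _ a b) (≤-reflexive (wt-swap-⋒ e z v w))
... | inj₁ (_ , inj₁ a)  | inj₂ (_ , b , _)   = c v w a b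
... | inj₁ (_ , inj₂ a)  | inj₂ (_ , _ , b)   = ≤-trans (c _ _ a b) (≤-reflexive (wt-swap-⋒ e z v w))
... | inj₂ (_ , a , _)   | inj₁ (_ , inj₁ b)  = c v w a b
... | inj₂ (_ , _ , a)   | inj₁ (_ , inj₂ b)  = ≤-trans (c _ _ a b) (≤-reflexive (wt-swap-⋒ e z v w))
... | inj₂ (_ , a , _)   | inj₂ (_ , b , _)   = c v w a b

Stable : Fin n → Fin n → Fam n → Set
Stable e z G = ∀ v → G v ≡ true → lookup v e ≡ false → lookup v z ≡ true → G (swap e z v) ≡ true

S-Stable : (e z : Fin n) (G : Fam n) → Stable e z (S e z G)
S-Stable e z G v p i j with S-∋ e z G v p
... | inj₁ (i′ , _)      = ⊥-elim (false≢true (trans (sym i) i′))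
... | inj₂ (_ , _ , q) = ∋-S-true e z G (swap e z v) (trans (lookup-swap-e e z v) j) q

-- A shifted member avoiding `e` was a member before, hence so was its move from `z′` to `e`, and
-- the shift keeps every member containing `e`.
S-keeps-Stable : (e z z′ : Fin n) {G : Fam n} → Stable e z′ G → Stable e z′ (S e z G)
S-keeps-Stable e z z′ {G} s v p i j with S-∋ e z G v p
... | inj₁ (i′ , _)    = ⊥-elim (false≢true (trans (sym i) i′))
... | inj₂ (_ , q , _) = ∋-S-true e z G (swap e z′ v) (trans (lookup-swap-e e z′ v) j) (s v q i j)

-- Here the source `z` is fixed and the targets vary. A shifted member containing `z` was a member
-- before; its move to `e′` lacks `z`, so the shift towards `e` leaves that set in place.
S-keeps-Stable′ : (z e e′ : Fin n) {G : Fam n} → Stable e′ z G → Stable e′ z (S e z G)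
S-keeps-Stable′ z e e′ {G} s v p i j = member (lookup (swap e′ z v) e) refl
  where
  G-v : G v ≡ true
  G-v with S-∋ e z G v p
  ... | inj₁ (_ , inj₁ q)   = q
  ... | inj₁ (i′ , inj₂ q)  = subst (λ u → G u ≡ true) (swap-same e z v (trans i′ (sym j))) q
  ... | inj₂ (_ , q , _)    = q
  G-sv : G (swap e′ z v) ≡ true
  G-sv = s v G-v i j
  member : ∀ b → lookup (swap e′ z v) e ≡ b → S e z G (swap e′ z v) ≡ true
  member true  r = ∋-S-true e z G _ r G-sv
  member false r = ∋-S-same e z G _ (trans r (sym (trans (lookup-swap-z e′ z v) i))) G-sv

-- Shifting towards one element and away from one element

pull : Fin n → List (Fin n) → Fam n → Fam n
pull e []       G = G
pull e (z ∷ zs) G = pull e zs (S e z G)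

pull-# : (e : Fin n) (zs : List (Fin n)) (G : Fam n) → # (pull e zs G) ≡ # G
pull-# e []       G = refl
pull-# e (z ∷ zs) G = trans (pull-# e zs (S e z G)) (S-# e z G)

pull-Unif : (e : Fin n) (zs : List (Fin n)) {G : Fam n} → Unif k G → Unif k (pull e zs G)
pull-Unif e []       u = u
pull-Unif e (z ∷ zs) u = pull-Unif e zs (S-Unif e z u)

pull-Cross : (e : Fin n) (zs : List (Fin n)) {A B : Fam n} → Cross t A B → Cross t (pull e zs A) (pull e zs B)
pull-Cross e []       c = c
pull-Cross e (z ∷ zs) c = pull-Cross e zs (S-Cross e z c)

pull-keeps-Stable : (e : Fin n) (zs : List (Fin n)) {z : Fin n} {G : Fam n} → Stable e z G → Stable e z (pull e zs G)
pull-keeps-Stable e []       s = s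
pull-keeps-Stable e (z ∷ zs) s = pull-keeps-Stable e zs (S-keeps-Stable e z _ s)

pull-Stable : (e : Fin n) (zs : List (Fin n)) {z : Fin n} (G : Fam n) → z ∈ zs → Stable e z (pull e zs G)
pull-Stable e (z ∷ zs) G (here refl) = pull-keeps-Stable e zs (S-Stable e z G)
pull-Stable e (_ ∷ zs) G (there i)   = pull-Stable e zs (S e _ G) i

pull-induction : (e : Fin n) (zs : List (Fin n)) (P : Fam n → Set) →
  (∀ {z} → z ∈ zs → ∀ {G} → P G → P (S e z G)) → ∀ {G} → P G → P (pull e zs G)
pull-induction e []       P step p = p
pull-induction e (z ∷ zs) P step p = pull-induction e zs P (step ∘ there) (step (here refl) p)

push : Fin n → List (Fin n) → Fam n → Fam n
push z []       G = G
push z (e ∷ es) G = push z es (S e z G)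

push-# : (z : Fin n) (es : List (Fin n)) (G : Fam n) → # (push z es G) ≡ # G
push-# z []       G = refl
push-# z (e ∷ es) G = trans (push-# z es (S e z G)) (S-# e z G)

push-Unif : (z : Fin n) (es : List (Fin n)) {G : Fam n} → Unif k G → Unif k (push z es G)
push-Unif z []       u = u
push-Unif z (e ∷ es) u = push-Unif z es (S-Unif e z u)

push-Cross : (z : Fin n) (es : List (Fin n)) {A B : Fam n} → Cross t A B → Cross t (push z es A) (push z es B)
push-Cross z []       c = c
push-Cross z (e ∷ es) c = push-Cross z es (S-Cross e z c)

push-keeps-Stable : (z : Fin n) (es : List (Fin n)) {e : Fin n} {G : Fam n} → Stable e z G → Stable e z (push z es G)
push-keeps-Stable z []       s = s
push-keeps-Stable z (e ∷ es) s = push-keeps-Stable z es (S-keeps-Stable′ z e _ s)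

push-Stable : (z : Fin n) (es : List (Fin n)) {e : Fin n} (G : Fam n) → e ∈ es → Stable e z (push z es G)
push-Stable z (e ∷ es) G (here refl) = push-keeps-Stable z es (S-Stable e z G)
push-Stable z (_ ∷ es) G (there i)   = push-Stable z es (S _ z G) i

-- Raising the intersection number

has lacks : Fin n → Fam n
has x v = lookup v x
lacks x v = not (lookup v x)

not-true : ∀ {b} → not b ≡ true → b ≡ false
not-true {false} _ = refl

wt-pos : (v : Vec Bool n) → 1 ≤ wt v → ∃ λ z → lookup v z ≡ true
wt-pos (true  ∷ v) p = zero , refl
wt-pos (false ∷ v) p with wt-pos v p
... | z , q = suc z , q

-- Let `v` and `w` avoid `e` and share `z`. Replacing `z` by `e` in `v` loses `z` from the
-- intersection and gains nothing, yet the lower bound holds afterwards too. Stability is asked only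
-- for a `z` common to both sets, so that families with opposite traces on two elements qualify.
Cross-gain : (e : Fin n) {A B : Fam n} →
  (∀ v w z → A v ≡ true → B w ≡ true → lookup v e ≡ false → lookup v z ≡ true → lookup w z ≡ true → A (swap e z v) ≡ true) →
  Cross (suc t) A B → Cross (suc (suc t)) (A ∩ lacks e) (B ∩ lacks e)
Cross-gain {t = t} e {A} {B} stable c v w p q = common (wt-pos (v ⋒ w) (≤-trans (s≤s z≤n) (c v w Av Bw)))
  where
  Av  = proj₁ (∧-true p)
  Bw  = proj₁ (∧-true q)
  v-e = not-true (proj₂ (∧-true {A v} p))
  w-e = not-true (proj₂ (∧-true {B w} q))
  common : (∃ λ z → lookup (v ⋒ w) z ≡ true) → suc (suc t) ≤ wt (v ⋒ w)
  common (z , r) = ≤-trans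
      (s≤s (c _ w (stable v w z Av Bw v-e v-z w-z) Bw))
      (≤-reflexive (trans (cong (suc ∘ wt) (⋒-comm (swap e z v) w)) (trans one-less (cong wt (⋒-comm w v)))))
    where
    v-z = proj₁ (∧-true (trans (sym (lookup-⋒ z v w)) r))
    w-z = proj₂ (∧-true {lookup v z} (trans (sym (lookup-⋒ z v w)) r))
    one-less : suc (wt (w ⋒ swap e z v)) ≡ wt (w ⋒ v)
    one-less = bits v-e v-z w-e w-z
      (wt-⋒-swap {e = e} {z} (λ { refl → false≢true (trans (sym v-e) v-z) }) w v)
      where
      bits : ∀ {a b c d X Y} → a ≡ false → b ≡ true → c ≡ false → d ≡ true →
        (bit (d ∧ b) + bit (c ∧ a)) + X ≡ (bit (d ∧ a) + bit (c ∧ b)) + Y → suc X ≡ Y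
      bits refl refl refl refl eq = eq

-- Binomial coefficients

ch : ℕ → ℕ → ℕ
ch n       zero    = 1
ch zero    (suc k) = 0
ch (suc n) (suc k) = ch n k + ch n (suc k)

nC0≡1 : ∀ n → n C 0 ≡ 1
nC0≡1 n = trans (nCk≡nC[n∸k] {0} {n} z≤n) (nCn≡1 n)

-- Pascal's rule holds for `ch` by definition, matching the split of a family by its first element;
-- this translation serves the symmetry and the final statement.
ch≡C : ∀ n k → ch n k ≡ n C k
ch≡C n       zero    = sym (nC0≡1 n)
ch≡C zero    (suc k) = refl
ch≡C (suc n) (suc k) = trans (cong₂ _+_ (ch≡C n k) (ch≡C n (suc k))) (nCk+nC[k+1]≡[n+1]C[k+1] n k)

ch-sym : ∀ p q → ch (p + q) p ≡ ch (p + q) q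
ch-sym p q = trans (ch≡C (p + q) p) (trans (nCk≡nC[n∸k] (m≤m+n p q))
  (trans (cong ((p + q) C_) (m+n∸m≡n p q)) (sym (ch≡C (p + q) q))))

ch-diag : ∀ n → ch n n ≡ 1
ch-diag n = trans (ch≡C n n) (nCn≡1 n)

-- chm m a s is the binomial coefficient (m choose a − s), which is 0 for a < s.
chm : ℕ → ℕ → ℕ → ℕ
chm m a       zero    = ch m a
chm m zero    (suc s) = 0
chm m (suc a) (suc s) = chm m a s

chm-pascal : ∀ m a s → chm (suc m) a s ≡ chm m a s + chm m a (suc s)
chm-pascal m zero    zero    = refl
chm-pascal m zero    (suc s) = refl
chm-pascal m (suc a) zero    = +-comm (ch m a) (ch m (suc a))
chm-pascal m (suc a) (suc s) = chm-pascal m a s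

-- Uniform and cross t-intersecting families

Unif-zero : {A : Fam (suc m)} → Unif 0 A → # (A ∘ (true ∷_)) ≡ 0
Unif-zero u = #-empty λ v p → 1+n≢0 (u (true ∷ v) p)

Unif-true : {A : Fam (suc m)} → Unif (suc k) A → Unif k (A ∘ (true ∷_))
Unif-true u v p = suc-injective (u (true ∷ v) p)

Unif-false : {A : Fam (suc m)} → Unif k A → Unif k (A ∘ (false ∷_))
Unif-false u v p = u (false ∷ v) p

Unif-# : ∀ a (A : Fam m) → Unif a A → # A ≤ ch m a
Unif-# {zero}  zero    A u with A []
... | true  = ≤-refl
... | false = z≤n
Unif-# {zero}  (suc a) A u = ≤-reflexive (#-empty {G = A} λ { [] p → 1+n≢0 (sym (u [] p)) })
Unif-# {suc m} zero    A u = ≤-trans (≤-reflexive (cong (_+ # (A ∘ (false ∷_))) (Unif-zero {A = A} u)))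
                                     (Unif-# zero (A ∘ (false ∷_)) (Unif-false {A = A} u))
Unif-# {suc m} (suc a) A u = +-mono-≤ (Unif-# a (A ∘ (true ∷_)) (Unif-true {A = A} u))
                                      (Unif-# (suc a) (A ∘ (false ∷_)) (Unif-false {A = A} u))

-- The reflection principle for random walks in disguise: prepending an element changes the
-- exponent s by −1 or +1 according to its membership, and C(m+1, a−s) splits accordingly
-- as C(m, (a−1)−(s−1)) + C(m, a−(s+1)).
Cross-t-bound : ∀ m a b s u t (A B : Fam m) → Unif a A → Unif b B → Cross t A B → s + u ≡ t + t →
  # A ≤ chm m a s ⊎ # B ≤ chm m b u
Cross-t-bound m a b zero    u       t A B uA uB c eq = inj₁ (Unif-# a A uA)
Cross-t-bound m a b (suc s) zero    t A B uA uB c eq = inj₂ (Unif-# b B uB)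
Cross-t-bound m a b (suc s) (suc u) zero A B uA uB c ()
Cross-t-bound m a b (suc s) (suc u) (suc t) A B uA uB c eq with #-member A | #-member B
... | inj₁ p | _      = inj₁ (≤-trans (≤-reflexive p) z≤n)
... | inj₂ _ | inj₁ q = inj₂ (≤-trans (≤-reflexive q) z≤n)
Cross-t-bound m zero b (suc s) (suc u) (suc t) A B uA uB c eq | inj₂ (v , p) | inj₂ (w , q) =
  ⊥-elim (<⇒≱ (s≤s z≤n) (≤-trans (c v w p q) (≤-trans (wt-⋒ˡ v w) (≤-reflexive (uA v p)))))
Cross-t-bound m (suc a) zero (suc s) (suc u) (suc t) A B uA uB c eq | inj₂ (v , p) | inj₂ (w , q) =
  ⊥-elim (<⇒≱ (s≤s z≤n) (≤-trans (c v w p q) (≤-trans (wt-⋒ʳ v w) (≤-reflexive (uB w q)))))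
Cross-t-bound zero (suc a) (suc b) (suc s) (suc u) (suc t) A B uA uB c eq | inj₂ ([] , p) | _ =
  ⊥-elim (1+n≢0 (sym (uA [] p)))
Cross-t-bound (suc m) (suc a) (suc b) (suc s) (suc u) (suc t) A B uA uB c eq | inj₂ _ | inj₂ _ =
  -- After the shift, the intersection bound for the rest falls by one if both sets contain the
  -- first element, stays if exactly one does, and rises by one (`gain`) if neither does. In all
  -- four cases the two exponents still add up to twice this bound.
  combine (Cross-t-bound m a b s u t (A′ true) (B′ true) uA₁ uB₁ (λ v w p q → ≤-pred (cross _ _ p q)) eq₀)
          (Cross-t-bound m (suc a) b (2 + s) u (suc t) (A′ false) (B′ true) uA₀ uB₁ (λ v w → cross _ _) eq₁)
          (Cross-t-bound m a (suc b) s (2 + u) (suc t) (A′ true) (B′ false) uA₁ uB₀ (λ v w → cross _ _) eq₂)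
          (Cross-t-bound m (suc a) (suc b) (2 + s) (2 + u) (2 + t) (A′ false) (B′ false) uA₀ uB₀ gain eq₃)
  where
  zs = allFin (suc m)
  A* = pull zero zs A
  B* = pull zero zs B
  A′ B′ : Bool → Fam m
  A′ x v = A* (x ∷ v)
  B′ x v = B* (x ∷ v)
  cross : Cross (suc t) A* B*
  cross = pull-Cross zero zs c
  uA* = pull-Unif zero zs uA
  uB* = pull-Unif zero zs uB
  uA₁ = Unif-true {A = A*} uA*
  uA₀ = Unif-false {A = A*} uA*
  uB₁ = Unif-true {A = B*} uB*
  uB₀ = Unif-false {A = B*} uB*
  gain : Cross (2 + t) (A′ false) (B′ false)
  gain v w p q = Cross-gain zero
    (λ v′ w′ z p′ _ i j _ → pull-Stable zero zs A (∈-allFin z) v′ p′ i j) cross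
    (false ∷ v) (false ∷ w) (trans (∧-identityʳ _) p) (trans (∧-identityʳ _) q)
  double : ∀ x y z → suc x + suc y ≡ suc z + suc z → x + y ≡ z + z
  double x y z e = suc-injective (trans (sym (+-suc x y)) (trans (suc-injective e) (+-suc z z)))
  eq₀ : s + u ≡ t + t
  eq₀ = double s u t eq
  two : suc t + suc t ≡ 2 + (t + t)
  two = cong suc (+-suc t t)
  eq₁ : 2 + s + u ≡ suc t + suc t
  eq₁ = trans (cong (2 +_) eq₀) (sym two)
  eq₂ : s + (2 + u) ≡ suc t + suc t
  eq₂ = trans (+-comm s (2 + u)) (trans (cong (2 +_) (trans (+-comm u s) eq₀)) (sym two))
  eq₃ : 2 + s + (2 + u) ≡ 2 + t + (2 + t)
  eq₃ = trans (four s u) (trans (cong (4 +_) eq₀) (sym (four t t)))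
    where
    four : ∀ x y → 2 + x + (2 + y) ≡ 4 + (x + y)
    four = solve-∀
  A-bound : # (A′ true) ≤ chm m a s → # (A′ false) ≤ chm m a (suc s) → # A ≤ chm (suc m) a s
  A-bound p q = ≤-trans (≤-reflexive (sym (pull-# zero zs A)))
    (≤-trans (+-mono-≤ p q) (≤-reflexive (sym (chm-pascal m a s))))
  B-bound : # (B′ true) ≤ chm m b u → # (B′ false) ≤ chm m b (suc u) → # B ≤ chm (suc m) b u
  B-bound p q = ≤-trans (≤-reflexive (sym (pull-# zero zs B)))
    (≤-trans (+-mono-≤ p q) (≤-reflexive (sym (chm-pascal m b u))))
  -- If one half of `A` fails its bound, the two alternatives naming that half put both halves of
  -- `B` within theirs.
  combine : # (A′ true) ≤ chm m a s ⊎ # (B′ true) ≤ chm m b u →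
            # (A′ false) ≤ chm m a (suc s) ⊎ # (B′ true) ≤ chm m b u →
            # (A′ true) ≤ chm m a s ⊎ # (B′ false) ≤ chm m b (suc u) →
            # (A′ false) ≤ chm m a (suc s) ⊎ # (B′ false) ≤ chm m b (suc u) →
            # A ≤ chm (suc m) a s ⊎ # B ≤ chm (suc m) b u
  combine (inj₁ p) (inj₁ q) _        _        = inj₁ (A-bound p q)
  combine (inj₁ p) (inj₂ _) _        (inj₁ q) = inj₁ (A-bound p q)
  combine (inj₁ _) (inj₂ p) _        (inj₂ q) = inj₂ (B-bound p q)
  combine (inj₂ p) _        (inj₂ q) _        = inj₂ (B-bound p q)
  combine (inj₂ _) _        (inj₁ p) (inj₁ q) = inj₁ (A-bound p q)
  combine (inj₂ p) _        (inj₁ _) (inj₂ q) = inj₂ (B-bound p q)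

-- Complements and the Kruskal-Katona theorem

flip : Vec Bool n → Vec Bool n
flip = map not

∑-flip : (f : Vec Bool n → ℕ) → ∑ (f ∘ flip) ≡ ∑ f
∑-flip {zero}  f = refl
∑-flip {suc n} f = trans (+-comm (∑ (λ v → f (false ∷ flip v))) _)
  (cong₂ _+_ (∑-flip (f ∘ (true ∷_))) (∑-flip (f ∘ (false ∷_))))

wt-flip : (v : Vec Bool n) → wt (flip v) + wt v ≡ n
wt-flip []          = refl
wt-flip (true  ∷ v) = trans (+-suc (wt (flip v)) (wt v)) (cong suc (wt-flip v))
wt-flip (false ∷ v) = cong suc (wt-flip v)

wt-⋒-flip : (v : Vec Bool n) → wt (v ⋒ flip v) ≡ 0
wt-⋒-flip []          = refl
wt-⋒-flip (true  ∷ v) = wt-⋒-flip v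
wt-⋒-flip (false ∷ v) = wt-⋒-flip v

layer : ℕ → Fam n
layer a v = wt v ≡ᵇ a

layer-# : ∀ m a → ch m a ≤ # (layer {m} a)
layer-# zero    zero    = ≤-refl
layer-# zero    (suc a) = z≤n
layer-# (suc m) zero    = ≤-trans (layer-# m zero) (m≤n+m (# (layer {m} zero)) _)
layer-# (suc m) (suc a) = +-mono-≤ (layer-# m a) (layer-# m (suc a))

disjoint-wt : (v w : Vec Bool n) → wt (v ⋒ w) ≡ 0 → wt v + wt w ≤ n
disjoint-wt []          []          p = z≤n
disjoint-wt (true  ∷ v) (false ∷ w) p = s≤s (disjoint-wt v w p)
disjoint-wt (false ∷ v) (true  ∷ w) p = ≤-trans (≤-reflexive (+-suc (wt v) (wt w))) (s≤s (disjoint-wt v w p))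
disjoint-wt (false ∷ v) (false ∷ w) p = m≤n⇒m≤1+n (disjoint-wt v w p)

disjoint-complement : (v w : Vec Bool n) → wt (v ⋒ w) ≡ 0 → wt v + wt w ≡ n → flip v ≡ w
disjoint-complement []          []          p q = refl
disjoint-complement (true  ∷ v) (false ∷ w) p q = cong (false ∷_) (disjoint-complement v w p (suc-injective q))
disjoint-complement (false ∷ v) (true  ∷ w) p q =
  cong (true ∷_) (disjoint-complement v w p (suc-injective (trans (sym (+-suc (wt v) (wt w))) q)))
disjoint-complement (false ∷ v) (false ∷ w) p q = ⊥-elim (<⇒≱ (≤-reflexive (sym q)) (disjoint-wt v w p))

-- Places the complement of `v` in the upper shadow of `w`; this is how `kruskal-katona` treats a
-- pair that fails to meet.
disjoint-missing-one : (v w : Vec Bool n) → wt (v ⋒ w) ≡ 0 → suc (wt v + wt w) ≡ n →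
  ∃ λ z → lookup w z ≡ false × flip v ≡ w [ z ]≔ true
disjoint-missing-one []          []          p ()
disjoint-missing-one (true  ∷ v) (false ∷ w) p q with disjoint-missing-one v w p (suc-injective q)
... | z , r , s = suc z , r , cong (false ∷_) s
disjoint-missing-one (false ∷ v) (true  ∷ w) p q
  with disjoint-missing-one v w p (suc-injective (trans (cong suc (sym (+-suc (wt v) (wt w)))) q))
... | z , r , s = suc z , r , cong (true ∷_) s
disjoint-missing-one (false ∷ v) (false ∷ w) p q =
  zero , refl , cong (true ∷_) (disjoint-complement v w p (suc-injective q))

#-disjoint : (A B : Fam n) → (∀ v → A v ≡ true → B v ≡ true → ⊥) → # A + # B ≡ # (λ v → A v ∨ B v)
#-disjoint A B d = trans (sym (∑-+ (bit ∘ A) (bit ∘ B))) (∑-cong λ v → bits (A v) (B v) (d v))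
  where
  bits : ∀ x y → (x ≡ true → y ≡ true → ⊥) → bit x + bit y ≡ bit (x ∨ y)
  bits true  true  d = ⊥-elim (d refl refl)
  bits true  false d = refl
  bits false y     d = refl

-- The complements of the members of `B` have size `a`, and none of them lies in `A`, because no set
-- meets its complement.
complementary-bound : ∀ m a b (A B : Fam m) → Unif a A → Unif b B → Cross 1 A B → b + a ≡ m → # A + # B ≤ ch m a
complementary-bound m a b A B uA uB c eq = ≤-trans
  (≤-reflexive (trans (cong (# A +_) (sym (∑-flip (bit ∘ B)))) (#-disjoint A (B ∘ flip)
    λ v p q → <⇒≱ (s≤s z≤n) (≤-trans (c v (flip v) p q) (≤-reflexive (wt-⋒-flip v))))))
  (Unif-# a (λ v → A v ∨ B (flip v)) unif)
  where
  unif : Unif a (λ v → A v ∨ B (flip v))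
  unif v p with ∨-true {A v} p
  ... | inj₁ q = uA v q
  ... | inj₂ q = +-cancelˡ-≡ b (wt v) a (trans (cong (_+ wt v) (sym (uB (flip v) q))) (trans (wt-flip v) (sym eq)))

-- Kruskal–Katona for the complements of the members of B, which have size g: if there are
-- at least (x choose g) of them, they contain at least (x choose a) sets of size a, none in A.
-- The induction is Frankl's: once B is closed under moving the first element elsewhere, the
-- members avoiding it number at least (x − 1 choose g − 1), since otherwise the upper shadow
-- of the remaining members would have to be larger than that.
kruskal-katona : ∀ m a b g x (A B : Fam m) → Unif a A → Unif b B → Cross 1 A B →
  b + g ≡ m → a ≤ g → g ≤ x → ch x g ≤ # B → # A + ch x a ≤ ch m a
kruskal-katona m a b g x A B uA uB c eq a≤g g≤x large with m≤n⇒m<n∨m≡n a≤g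
... | inj₂ refl = ≤-trans (+-monoʳ-≤ (# A) large) (complementary-bound m a b A B uA uB c eq)
kruskal-katona zero a b (suc g) x A B uA uB c eq _ _ _ | inj₁ _ = ⊥-elim (1+n≢0 (trans (sym (+-suc b g)) eq))
kruskal-katona (suc m) a b (suc g) (suc x) A B uA uB c eq _ (s≤s g≤x) large | inj₁ (s≤s a≤g)
  with ch x g ≤? # (λ v → push zero (allFin (suc m)) B (false ∷ v))
... | yes large₀ = bound a a≤g (push-Unif zero zs uA)
  where
  zs = allFin (suc m)
  A* = push zero zs A
  B* = push zero zs B
  A′ B′ : Bool → Fam m
  A′ y v = A* (y ∷ v)
  B′ y v = B* (y ∷ v)
  cross : Cross 1 A* B*
  cross = push-Cross zero zs c
  eq₀ : b + g ≡ m
  eq₀ = suc-injective (trans (sym (+-suc b g)) eq)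
  -- A member of `B*` avoiding the first element meets the members of both halves of `A*` elsewhere,
  -- and its complement in the remaining `m` points has size `g`. Pascal's rule then adds up the two
  -- halves in `bound`.
  ih : ∀ a y → a ≤ g → Unif a (A′ y) → # (A′ y) + ch x a ≤ ch m a
  ih a y a≤g u = kruskal-katona m a b g x (A′ y) (B′ false) u (Unif-false {A = B*} (push-Unif zero zs uB))
    (λ v w p q → ≤-trans (cross _ _ p q) (≤-reflexive (cong (λ d → bit d + wt (v ⋒ w)) (y∧false y))))
    eq₀ a≤g g≤x large₀
    where
    y∧false : ∀ y → y ∧ false ≡ false
    y∧false true  = refl
    y∧false false = refl
  bound : ∀ a → a ≤ g → Unif a A* → # A + ch (suc x) a ≤ ch (suc m) a
  bound zero    a≤g u = ≤-trans
    (≤-reflexive (cong (_+ 1) (trans (sym (push-# zero zs A)) (cong (_+ # (A′ false)) (Unif-zero {A = A*} u)))))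
    (ih zero false a≤g (Unif-false {A = A*} u))
  bound (suc a) a≤g u = ≤-trans
    (≤-reflexive (trans (cong (_+ ch (suc x) (suc a)) (sym (push-# zero zs A))) (interchange (# (A′ true)) _ _ _)))
    (+-mono-≤ (ih a true (<⇒≤ a≤g) (Unif-true {A = A*} u)) (ih (suc a) false a≤g (Unif-false {A = A*} u)))
... | no small₀ = ⊥-elim (small b uB eq)
  where
  zs = allFin (suc m)
  B* = push zero zs B
  B′ : Bool → Fam m
  B′ y v = B* (y ∷ v)
  -- Pascal's rule splits `ch (suc x) (suc g)`; as `B′ false` stays below `ch x g`, the rest lies in
  -- `B′ true`, with one to spare.
  large₁ : suc (ch x (suc g)) ≤ # (B′ true)
  large₁ = +-cancelˡ-≤ (# (B′ false)) _ _ (≤-trans (≤-reflexive (+-suc (# (B′ false)) _))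
    (≤-trans (+-monoˡ-≤ (ch x (suc g)) (≰⇒> small₀))
    (≤-trans large (≤-reflexive (trans (sym (push-# zero zs B)) (+-comm (# (B′ true)) _))))))
  small : ∀ b → Unif b B → b + suc g ≡ suc m → ⊥
  small zero    uB eq = <⇒≱ (s≤s z≤n) (≤-trans large₁ (≤-reflexive (Unif-zero {A = B*} (push-Unif zero zs uB))))
  small (suc b) uB eq = small₀ (growth (m≤n⇒m<n∨m≡n g≤x))
    where
    -- The `g`-sets that are not complements of members of `B′ false`. If one were disjoint from a
    -- member `w` of `B′ true`, its complement would be `w` plus one element, which lies in
    -- `B′ false` because `B*` is closed under moving the first element elsewhere.
    A″ : Fam m
    A″ v = layer g v ∧ not (B′ false (flip v))
    uB* = push-Unif zero zs uB
    uA″ : Unif g A″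
    uA″ v p = ≡ᵇ⇒≡ (wt v) g (subst T (sym (proj₁ (∧-true {layer g v} p))) _)
    sizes : ∀ x y → x ≡ g → y ≡ b → suc (x + y) ≡ m
    sizes _ _ refl refl = suc-injective (trans (cong suc (comm g b)) eq)
      where
      comm : ∀ g b → suc (g + b) ≡ b + suc g
      comm = solve-∀
    cross″ : Cross 1 A″ (B′ true)
    cross″ v w p q with wt (v ⋒ w) in r
    ... | suc _ = s≤s z≤n
    ... | zero with disjoint-missing-one v w r (sizes (wt v) (wt w) (uA″ v p) (Unif-true {A = B*} uB* w q))
    ... | z , i , j = ⊥-elim (false≢true (trans (sym (not-true (proj₂ (∧-true {layer g v} p))))
            (subst₂ (λ d u → B* (d ∷ u) ≡ true) i (sym j)
              (push-Stable zero zs B (∈-allFin (suc z)) (true ∷ w) q i refl))))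
    ih : ∀ x → suc g ≤ x → ch x (suc g) ≤ # (B′ true) → ch x g ≤ # (B′ false)
    ih x g≤x l = +-cancelˡ-≤ (# A″) _ _ (≤-trans
      (kruskal-katona m g b (suc g) x A″ (B′ true) uA″ (Unif-true {A = B*} uB*) cross″ (suc-injective eq) (n≤1+n g) g≤x l)
      (≤-trans (layer-# m g) (≤-trans
        (#-≤2 (layer g) A″ (B′ false ∘ flip) (λ v → bits (layer g v) (B′ false (flip v))))
        (≤-reflexive (cong (# A″ +_) (∑-flip (bit ∘ B′ false)))))))
      where
      bits : ∀ p q → bit p ≤ bit (p ∧ not q) + bit q
      bits = from-yes (∀𝔹? λ p → ∀𝔹? λ q → bit p ≤? bit (p ∧ not q) + bit q)
    growth : g < x ⊎ g ≡ x → ch x g ≤ # (B′ false)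
    growth (inj₁ g<x)  = ih x g<x (<⇒≤ large₁)
    -- Here `x = g` is too small for `ih`, but the one to spare in `large₁` yields a member of
    -- `B′ true`, so that `suc g` can replace `x`.
    growth (inj₂ refl) = ≤-trans (ch-suc g)
      (ih (suc g) ≤-refl (≤-trans (≤-reflexive (ch-diag (suc g))) (≤-trans (s≤s z≤n) large₁)))
      where
      ch-suc : ∀ g → ch g g ≤ ch (suc g) g
      ch-suc zero    = ≤-refl
      ch-suc (suc g) = m≤n+m (ch (suc g) (suc g)) (ch (suc g) g)

-- Binomial estimates and comparison with stars

ch-step : ∀ n k → ch n k ≤ ch (suc n) k
ch-step n zero    = ≤-refl
ch-step n (suc k) = m≤n+m (ch n (suc k)) (ch n k)

ch-mono : ∀ {n n′} k → n ≤ n′ → ch n k ≤ ch n′ k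
ch-mono {zero}  {zero}   k       z≤n       = ≤-refl
ch-mono {zero}  {suc n′} k       z≤n       = ≤-trans (ch-mono {zero} {n′} k z≤n) (ch-step n′ k)
ch-mono {suc n} {suc n′} zero    (s≤s n≤n′) = ≤-refl
ch-mono {suc n} {suc n′} (suc k) (s≤s n≤n′) = +-mono-≤ (ch-mono k n≤n′) (ch-mono (suc k) n≤n′)

-- The rule (k+1) C(n, k+1) = (n-k) C(n, k), freed of subtraction.
ch-absorb : ∀ n k → suc k * ch n (suc k) + k * ch n k ≡ n * ch n k
ch-absorb zero    zero    = refl
ch-absorb zero    (suc k) = cong₂ _+_ (*-zeroʳ k) (*-zeroʳ k)
ch-absorb (suc n) zero    = trans (step (ch n 1)) (cong suc (ch-absorb n zero))
  where
  step : ∀ y → 1 * (1 + y) + 0 ≡ suc (1 * y + 0)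
  step = solve-∀
ch-absorb (suc n) (suc k) = trans (left k (ch n k) (ch n (suc k)) (ch n (2 + k)))
  (trans (cong₂ (λ p q → ch n k + ch n (suc k) + p + q) (ch-absorb n k) (ch-absorb n (suc k)))
  (right n (ch n k) (ch n (suc k))))
  where
  left : ∀ k x y z → (2 + k) * (y + z) + (1 + k) * (x + y) ≡ x + y + ((1 + k) * y + k * x) + ((2 + k) * z + (1 + k) * y)
  left = solve-∀
  right : ∀ n x y → x + y + n * x + n * y ≡ (1 + n) * (x + y)
  right = solve-∀

-- The quotient of C(n, a) by C(n, a-1) is (n-a+1)/a, which the hypothesis makes at least `c`;
-- `ch-absorb` expresses this without division.
chm-ratio : ∀ n a c → a * c + a ≤ suc n → c * chm n a 1 ≤ ch n a
chm-ratio n zero    c p = ≤-trans (≤-reflexive (*-zeroʳ c)) z≤n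
chm-ratio n (suc k) c p = *-cancelˡ-≤ (suc k) (+-cancelʳ-≤ (k * ch n k) _ _ (begin
    suc k * (c * ch n k) + k * ch n k   ≡⟨ factor k c (ch n k) ⟩
    (suc k * c + k) * ch n k            ≤⟨ *-monoˡ-≤ (ch n k) (≤-pred (≤-trans (≤-reflexive (sym (+-suc (suc k * c) k))) p)) ⟩
    n * ch n k                          ≡⟨ sym (ch-absorb n k) ⟩
    suc k * ch n (suc k) + k * ch n k   ∎))
  where
  open ≤-Reasoning
  factor : ∀ k c x → (1 + k) * (c * x) + k * x ≡ ((1 + k) * c + k) * x
  factor = solve-∀

chm-step : ∀ n a s → chm n a s ≤ chm (suc n) a s
chm-step n a s = ≤-trans (m≤m+n (chm n a s) _) (≤-reflexive (sym (chm-pascal n a s)))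

chm-anti : ∀ n a s → a + a ≤ suc n → chm n a (suc s) ≤ chm n a s
chm-anti n a       zero    p = ≤-trans (≤-reflexive (sym (+-identityʳ _)))
  (chm-ratio n a 1 (≤-trans (≤-reflexive (cong (_+ a) (*-identityʳ a))) p))
chm-anti n zero    (suc s) p = z≤n
chm-anti n (suc a) (suc s) p = chm-anti n a s (≤-trans (+-mono-≤ (n≤1+n a) (n≤1+n a)) p)

chm-anti₁ : ∀ n a s → a + a ≤ suc n → chm n a (suc s) ≤ chm n a 1
chm-anti₁ n a zero    p = ≤-refl
chm-anti₁ n a (suc s) p = ≤-trans (chm-anti n a (suc s) p) (chm-anti₁ n a s p)

chm-+ : ∀ x j c → chm x (j + c) j ≡ ch x c
chm-+ x zero    c = refl
chm-+ x (suc j) c = chm-+ x j c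

chm-> : ∀ {x a s} → a < s → chm x a s ≡ 0
chm-> {a = zero}  {suc s} _         = refl
chm-> {a = suc a} {suc s} (s≤s a<s) = chm-> a<s

-- The threshold counts the `b`-sets containing `j` fixed elements, and `ch m a` exceeds `ch x a` by
-- the number of `a`-sets meeting those elements. Since C(m-j, b-j) = C(m-j, m-b), this is
-- `kruskal-katona` with complements of size `m ∸ b`.
kruskal-katona-star : ∀ {m} a b j x (A B : Fam m) → Unif a A → Unif b B → Cross 1 A B →
  j + x ≡ m → a + b ≤ m → chm x b j < # B → # A + ch x a ≤ ch m a
kruskal-katona-star {m} a b j x A B uA uB c eq a+b≤m large with ≤-total j b
... | inj₁ j≤b = kruskal-katona m a b g x A B uA uB c b+g≡m a≤g
      (≤-trans (m≤n+m g d) (≤-reflexive (sym x≡)))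
      (≤-trans (≤-reflexive (trans (cong (λ y → ch y g) x≡) (sym (ch-sym d g))))
      (≤-trans (≤-reflexive (cong (λ y → ch y d) (sym x≡)))
      (≤-trans (≤-reflexive (trans (sym (chm-+ x j d)) (cong (λ y → chm x y j) j+d≡b))) (<⇒≤ large))))
  where
  b≤m   = ≤-trans (m≤n+m b a) a+b≤m
  g     = m ∸ b
  d     = b ∸ j
  b+g≡m = m+[n∸m]≡n b≤m
  j+d≡b = m+[n∸m]≡n j≤b
  a≤g : a ≤ g
  a≤g = +-cancelˡ-≤ b a g (≤-trans (≤-reflexive (+-comm b a)) (≤-trans a+b≤m (≤-reflexive (sym b+g≡m))))
  x≡ : x ≡ d + g
  x≡ = +-cancelˡ-≡ j x (d + g) (trans eq (trans (sym b+g≡m) (trans (cong (_+ g) (sym j+d≡b)) (+-assoc j d g))))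
-- A star on at least `b` elements has at most one member. Here the existence of a member of `B` is
-- enough, with `g` in place of `x`.
... | inj₂ b≤j = ≤-trans (+-monoʳ-≤ (# A) (ch-mono a x≤g))
      (kruskal-katona m a b g g A B uA uB c b+g≡m a≤g ≤-refl
        (≤-trans (≤-reflexive (ch-diag g)) (≤-trans (s≤s z≤n) large)))
  where
  b≤m   = ≤-trans (m≤n+m b a) a+b≤m
  g     = m ∸ b
  b+g≡m = m+[n∸m]≡n b≤m
  a≤g : a ≤ g
  a≤g = +-cancelˡ-≤ b a g (≤-trans (≤-reflexive (+-comm b a)) (≤-trans a+b≤m (≤-reflexive (sym b+g≡m))))
  x≤g : x ≤ g
  x≤g = +-cancelˡ-≤ b x g (≤-trans (+-monoˡ-≤ x b≤j) (≤-reflexive (trans eq (sym b+g≡m))))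

ch-three : ∀ x a → ch (3 + x) a ≤ ch x a + 3 * chm (2 + x) a 1
ch-three x a = begin
    ch (3 + x) a                                            ≡⟨ chm-pascal (2 + x) a 0 ⟩
    ch (2 + x) a + d                                        ≡⟨ cong (_+ d) (chm-pascal (1 + x) a 0) ⟩
    ch (1 + x) a + chm (1 + x) a 1 + d                      ≡⟨ cong (λ y → y + chm (1 + x) a 1 + d) (chm-pascal x a 0) ⟩
    ch x a + chm x a 1 + chm (1 + x) a 1 + d                ≤⟨ +-monoˡ-≤ d (+-mono-≤ (+-monoʳ-≤ (ch x a)
                                                                 (≤-trans (chm-step x a 1) (chm-step (1 + x) a 1))) (chm-step (1 + x) a 1)) ⟩
    ch x a + d + d + d                                      ≡⟨ collect (ch x a) d ⟩
    ch x a + 3 * d ∎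
  where
  open ≤-Reasoning
  d = chm (2 + x) a 1
  collect : ∀ x d → x + d + d + d ≡ x + 3 * d
  collect = solve-∀

-- After reduction to `i = 0`, Pascal's rule bounds the left side by six times C(x, a-1), and
-- `chm-ratio` for the factor six asks for `7 * a`.
three-chm : ∀ x a i → 7 * a ≤ x → 3 * chm (suc x) a (suc i) ≤ ch x a
three-chm x a i p = begin
    3 * chm (suc x) a (suc i)          ≤⟨ *-monoʳ-≤ 3 (chm-anti₁ (suc x) a i (≤-trans 2a≤x (≤-trans (n≤1+n x) (n≤1+n (suc x))))) ⟩
    3 * chm (suc x) a 1                ≡⟨ cong (3 *_) (chm-pascal x a 1) ⟩
    3 * (chm x a 1 + chm x a 2)        ≤⟨ *-monoʳ-≤ 3 (+-monoʳ-≤ (chm x a 1) (chm-anti x a 1 (≤-trans 2a≤x (n≤1+n x)))) ⟩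
    3 * (chm x a 1 + chm x a 1)        ≡⟨ six (chm x a 1) ⟩
    6 * chm x a 1                      ≤⟨ chm-ratio x a 6 (≤-trans (≤-reflexive (seven a)) (≤-trans p (n≤1+n x))) ⟩
    ch x a ∎
  where
  open ≤-Reasoning
  six : ∀ d → 3 * (d + d) ≡ 6 * d
  six = solve-∀
  seven : ∀ a → a * 6 + a ≡ 7 * a
  seven = solve-∀
  2a≤x : a + a ≤ x
  2a≤x = ≤-trans (≤-trans (m≤m+n (a + a) (5 * a)) (≤-reflexive (split a))) p
    where
    split : ∀ a → a + a + 5 * a ≡ 7 * a
    split = solve-∀

-- Shifts and degrees

Fixes : Fin n → Fin n → Fam n → Set
Fixes e z c = ∀ v → c (swap e z v) ≡ c v

has-Fixes : {e z x : Fin n} → x ≢ e → x ≢ z → Fixes e z (has x)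
has-Fixes p q v = lookup-swap-≢ p q v

lacks-Fixes : {e z x : Fin n} → x ≢ e → x ≢ z → Fixes e z (lacks x)
lacks-Fixes p q v = cong not (lookup-swap-≢ p q v)

-- A condition preserved by the swap selects whole pairs of exchanged sets, so the shift acts on the
-- selected part by itself.
S-∩ : (e z : Fin n) (G : Fam n) {c : Fam n} → Fixes e z c → ∀ v → (S e z G ∩ c) v ≡ S e z (G ∩ c) v
S-∩ e z G {c} f v rewrite f v = bits (lookup v e) (G v) (G (swap e z v)) (c v)
  where
  bits : ∀ b x y d → (if b then x ∨ y else x ∧ y) ∧ d ≡ (if b then (x ∧ d) ∨ (y ∧ d) else (x ∧ d) ∧ (y ∧ d))
  bits true  true  y     true  = refl
  bits true  true  y     false = sym (∧-zeroʳ y)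
  bits true  false y     d     = refl
  bits false true  true  d     = sym (∧-idem d)
  bits false true  false d     = sym (∧-zeroʳ d)
  bits false false y     d     = refl

S-∩-# : (e z : Fin n) (G : Fam n) {c : Fam n} → Fixes e z c → # (S e z G ∩ c) ≡ # (G ∩ c)
S-∩-# e z G {c} f = trans (#-cong (S-∩ e z G f)) (S-# e z (G ∩ c))

-- Away from `e` and `z` the two sets of a pair agree, so degrees do not change there; `z` itself
-- can only lose members.
S-has-≢ : (e z : Fin n) (G : Fam n) {y : Fin n} → y ≢ e → # (S e z G ∩ has y) ≤ # (G ∩ has y)
S-has-≢ e z G {y} y≢e with y ≟ᶠ z
... | no y≢z   = ≤-reflexive (S-∩-# e z G (has-Fixes y≢e y≢z))
... | yes refl = #-≤1 {G = S e z G ∩ has z} {H = G ∩ has z} λ v → bits (lookup v e) (lookup v z) (G v) (G (swap e z v))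
                   λ p → cong G (swap-same e z v p)
  where
  bits : ∀ b c x y → (b ≡ c → y ≡ x) → bit ((if b then x ∨ y else x ∧ y) ∧ c) ≤ bit (x ∧ c)
  bits true  true  x     y     p rewrite p refl | ∨-idem x = ≤-refl
  bits true  false x     y     p rewrite ∧-zeroʳ (x ∨ y) = z≤n
  bits false c     true  true  p = ≤-refl
  bits false c     true  false p = z≤n
  bits false c     false y     p = ≤-refl

-- A new set containing `e` is the swap of a member containing `z`.
S-has-e : (e z : Fin n) (G : Fam n) → # (S e z G ∩ has e) ≤ # (G ∩ has e) + # (G ∩ has z)
S-has-e e z G = ≤-trans
  (#-≤2 (S e z G ∩ has e) (G ∩ has e) ((G ∩ has z) ∘ swap e z) λ v →
    subst (λ d → bit ((S e z G ∩ has e) v) ≤ bit ((G ∩ has e) v) + bit (G (swap e z v) ∧ d))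
      (sym (lookup-swap-z e z v)) (bits (lookup v e) (G v) (G (swap e z v))))
  (≤-reflexive (cong (# (G ∩ has e) +_) (∑-swap e z (bit ∘ (G ∩ has z)))))
  where
  bits : ∀ b x y → bit ((if b then x ∨ y else x ∧ y) ∧ b) ≤ bit (x ∧ b) + bit (y ∧ b)
  bits = from-yes (∀𝔹? λ b → ∀𝔹? λ x → ∀𝔹? λ y →
    bit ((if b then x ∨ y else x ∧ y) ∧ b) ≤? bit (x ∧ b) + bit (y ∧ b))

S-∩₂ : (e z : Fin n) (G : Fam n) {c d : Fam n} → Fixes e z c → Fixes e z d →
  ∀ v → (S e z G ∩ c ∩ d) v ≡ S e z (G ∩ c ∩ d) v
S-∩₂ e z G {c} {d} f g v = trans (cong (_∧ d v) (S-∩ e z G f v)) (S-∩ e z (G ∩ c) g v)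

-- This and the next two take a family that agrees pointwise with a shift, the form in which `S-∩`
-- and `S-∩₂` deliver restrictions of shifted families.
≗S-# : {e z : Fin n} (H : Fam n) {H′ : Fam n} → (∀ v → H′ v ≡ S e z H v) → # H′ ≡ # H
≗S-# {e = e} {z} H p = trans (#-cong p) (S-# e z H)

≗S-has-≢ : {e z : Fin n} (H : Fam n) {H′ : Fam n} → (∀ v → H′ v ≡ S e z H v) →
  {y : Fin n} → y ≢ e → # (H′ ∩ has y) ≤ # (H ∩ has y)
≗S-has-≢ {e = e} {z} H p {y} y≢e = ≤-trans
  (≤-reflexive (#-cong λ v → cong (_∧ lookup v y) (p v))) (S-has-≢ e z H y≢e)

≗S-has-e : {e z : Fin n} (H : Fam n) {H′ : Fam n} → (∀ v → H′ v ≡ S e z H v) →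
  # (H′ ∩ has e) ≤ # (H ∩ has e) + # (H ∩ has z)
≗S-has-e {e = e} {z} H p = ≤-trans
  (≤-reflexive (#-cong λ v → cong (_∧ lookup v e) (p v))) (S-has-e e z H)

-- Links

is : Bool → Fin n → Fam n
is true  = has
is false = lacks

∑-insert : (x : Fin (suc n)) (f : Vec Bool (suc n) → ℕ) →
  ∑ f ≡ ∑ (λ v → f (insertAt v x true)) + ∑ (λ v → f (insertAt v x false))
∑-insert         zero    f = refl
∑-insert {suc n} (suc x) f =
  trans (cong₂ _+_ (∑-insert x (f ∘ (true ∷_))) (∑-insert x (f ∘ (false ∷_))))
        (interchange (∑ λ v → f (true ∷ insertAt v x true)) _ _ _)

lookup-insert-≢ : {x y : Fin (suc n)} (x≢y : x ≢ y) (a : Bool) (v : Vec Bool n) →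
  lookup (insertAt v x a) y ≡ lookup v (punchOut x≢y)
lookup-insert-≢ {x = x} x≢y a v = trans
  (cong (lookup (insertAt v x a)) (sym (punchIn-punchOut x≢y))) (insertAt-punchIn v x a (punchOut x≢y))

is-insert-≢ : {x y : Fin (suc n)} (x≢y : x ≢ y) (a b : Bool) (v : Vec Bool n) →
  is b y (insertAt v x a) ≡ is b (punchOut x≢y) v
is-insert-≢ x≢y a true  v = lookup-insert-≢ x≢y a v
is-insert-≢ x≢y a false v = cong not (lookup-insert-≢ x≢y a v)

wt-insert : (x : Fin (suc n)) (a : Bool) (v : Vec Bool n) → wt (insertAt v x a) ≡ bit a + wt v
wt-insert zero    a v       = refl
wt-insert (suc x) a (b ∷ v) = trans (cong (bit b +_) (wt-insert x a v)) (comm₃ (bit b) (bit a) (wt v))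

⋒-insert : (x : Fin (suc n)) (a b : Bool) (v w : Vec Bool n) →
  insertAt v x a ⋒ insertAt w x b ≡ insertAt (v ⋒ w) x (a ∧ b)
⋒-insert zero    a b v       w       = refl
⋒-insert (suc x) a b (c ∷ v) (d ∷ w) = cong (c ∧ d ∷_) (⋒-insert x a b v w)

link-# : (G : Fam (suc n)) (a : Bool) (x : Fin (suc n)) → # (G ∩ is a x) ≡ # (λ v → G (insertAt v x a))
link-# G true x = trans (∑-insert x (bit ∘ (G ∩ has x)))
  (trans (cong₂ _+_
    (#-cong λ v → trans (cong (G (insertAt v x true) ∧_) (insertAt-lookup v x true)) (∧-identityʳ _))
    (#-empty λ v p → false≢true (trans (sym (insertAt-lookup v x false)) (proj₂ (∧-true {G (insertAt v x false)} p)))))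
  (+-identityʳ _))
link-# G false x = trans (∑-insert x (bit ∘ (G ∩ lacks x)))
  (cong₂ _+_
    (#-empty λ v p → false≢true (trans (sym (cong not (insertAt-lookup v x true))) (proj₂ (∧-true {G (insertAt v x true)} p))))
    (#-cong λ v → trans (cong (λ d → G (insertAt v x false) ∧ not d) (insertAt-lookup v x false)) (∧-identityʳ _)))

-- The position `y′` is that of `y` once `x` is deleted. Through `ι a b`, which reinserts both, the
-- sets with a given trace become a family on `m` points.
module Link₂ {m : ℕ} {x y : Fin (2 + m)} (x≢y : x ≢ y) where

  y′ : Fin (suc m)
  y′ = punchOut x≢y

  ι : Bool → Bool → Vec Bool m → Vec Bool (2 + m)
  ι a b v = insertAt (insertAt v y′ b) x a

  ι-# : (G : Fam (2 + m)) (a b : Bool) → # (G ∩ is a x ∩ is b y) ≡ # (G ∘ ι a b)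
  ι-# G a b = begin
      # (G ∩ is a x ∩ is b y)
    ≡⟨ #-cong (λ v → ∧-exchange (G v) (is a x v) (is b y v)) ⟩
      # (G ∩ is b y ∩ is a x)
    ≡⟨ link-# (G ∩ is b y) a x ⟩
      # (λ v → G (insertAt v x a) ∧ is b y (insertAt v x a))
    ≡⟨ #-cong (λ v → cong (G (insertAt v x a) ∧_) (is-insert-≢ x≢y a b v)) ⟩
      # ((λ v → G (insertAt v x a)) ∩ is b y′)
    ≡⟨ link-# (λ v → G (insertAt v x a)) b y′ ⟩
      # (G ∘ ι a b) ∎
    where
    open ≡-Reasoning

  ι-wt : ∀ a b v → wt (ι a b v) ≡ bit a + (bit b + wt v)
  ι-wt a b v = trans (wt-insert x a _) (cong (bit a +_) (wt-insert y′ b v))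

  ι-⋒ : ∀ a b a′ b′ v w → ι a b v ⋒ ι a′ b′ w ≡ ι (a ∧ a′) (b ∧ b′) (v ⋒ w)
  ι-⋒ a b a′ b′ v w = trans (⋒-insert x a a′ _ _) (cong (λ u → insertAt u x (a ∧ a′)) (⋒-insert y′ b b′ v w))

module Link₃ {m : ℕ} {x y z : Fin (3 + m)} (x≢y : x ≢ y) (x≢z : x ≢ z) (y≢z : y ≢ z) where

  module L = Link₂ {m} {punchOut x≢y} {punchOut x≢z} (λ p → y≢z (punchOut-injective x≢y x≢z p))

  ι : Bool → Bool → Bool → Vec Bool m → Vec Bool (3 + m)
  ι a b c v = insertAt (L.ι b c v) x a

  ι-# : (G : Fam (3 + m)) (a b c : Bool) → # (G ∩ is a x ∩ is b y ∩ is c z) ≡ # (G ∘ ι a b c)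
  ι-# G a b c = begin
      # (G ∩ is a x ∩ is b y ∩ is c z)
    ≡⟨ #-cong (λ v → rearrange (G v) (is a x v) (is b y v) (is c z v)) ⟩
      # (G ∩ is b y ∩ is c z ∩ is a x)
    ≡⟨ link-# (G ∩ is b y ∩ is c z) a x ⟩
      # (λ v → (G (insertAt v x a) ∧ is b y (insertAt v x a)) ∧ is c z (insertAt v x a))
    ≡⟨ #-cong (λ v → cong₂ (λ p q → (G (insertAt v x a) ∧ p) ∧ q) (is-insert-≢ x≢y a b v) (is-insert-≢ x≢z a c v)) ⟩
      # ((λ v → G (insertAt v x a)) ∩ is b (punchOut x≢y) ∩ is c (punchOut x≢z))
    ≡⟨ L.ι-# (λ v → G (insertAt v x a)) b c ⟩
      # (G ∘ ι a b c) ∎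
    where
    open ≡-Reasoning
    rearrange : ∀ p q r s → ((p ∧ q) ∧ r) ∧ s ≡ ((p ∧ r) ∧ s) ∧ q
    rearrange true  q r s = trans (∧-assoc q r s) (∧-comm q (r ∧ s))
    rearrange false q r s = refl

  ι-wt : ∀ a b c v → wt (ι a b c v) ≡ bit a + (bit b + (bit c + wt v))
  ι-wt a b c v = trans (wt-insert x a _) (cong (bit a +_) (L.ι-wt b c v))

  ι-⋒ : ∀ a b c a′ b′ c′ v w → ι a b c v ⋒ ι a′ b′ c′ w ≡ ι (a ∧ a′) (b ∧ b′) (c ∧ c′) (v ⋒ w)
  ι-⋒ a b c a′ b′ c′ v w = trans (⋒-insert x a a′ _ _)
    (cong (λ u → insertAt u x (a ∧ a′)) (L.ι-⋒ b c b′ c′ v w))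

-- Families with a fixed trace

module Large (m a p : ℕ) (m≡ : 3 + p ≡ m) (p-large : 2 + 36 * a ≤ p) where

  -- In terms of the theorem, `m` is n-3 and `a` is k-2. The remaining `p` points are those outside
  -- a star's three elements when Kruskal-Katona is applied on `m` points.
  D N : ℕ
  D = chm m a 1
  N = ch m a

  p≤m : p ≤ m
  p≤m = ≤-trans (m≤n+m p 3) (≤-reflexive m≡)

  a≤36a : a ≤ 36 * a
  a≤36a = m≤m+n a (35 * a)

  2a≤36a : a + a ≤ 36 * a
  2a≤36a = +-monoʳ-≤ a (m≤m+n a (34 * a))

  2a≤p : a + a ≤ p
  2a≤p = ≤-trans 2a≤36a (≤-trans (m≤n+m (36 * a) 2) p-large)

  a+[2+a]≤m : a + (2 + a) ≤ m
  a+[2+a]≤m = ≤-trans (≤-reflexive (collect a)) (≤-trans (+-monoʳ-≤ 2 2a≤36a) (≤-trans p-large p≤m))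
    where
    collect : ∀ a → a + (2 + a) ≡ 2 + (a + a)
    collect = solve-∀

  -- The source of the factor 36: the quotient (m-a+1)/a reaches 35 once `36 * a` is at most
  -- `suc m`.
  35D≤N : 35 * D ≤ N
  35D≤N = chm-ratio m a 35 (≤-trans (≤-reflexive (collect a))
    (≤-trans (m≤n+m (36 * a) 2) (≤-trans p-large (≤-trans p≤m (n≤1+n m)))))
    where
    collect : ∀ a → a * 35 + a ≡ 36 * a
    collect = solve-∀

  D-step : chm p a 1 ≤ D × chm (suc p) a 1 ≤ D
  D-step = ≤-trans (chm-step p a 1) one , one
    where
    one : chm (suc p) a 1 ≤ D
    one = subst (λ w → chm (suc p) a 1 ≤ chm w a 1) m≡
      (≤-trans (chm-step (suc p) a 1) (chm-step (2 + p) a 1))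

  -- Hence at most `3 * D` of the `a`-sets meet three given points.
  ch-drop : ch m a ≤ 3 * D + ch p a
  ch-drop = subst (λ w → ch w a ≤ 3 * chm w a 1 + ch p a) m≡ (≤-trans (ch-three p a)
    (≤-trans (+-monoʳ-≤ (ch p a) (*-monoʳ-≤ 3 (chm-step (2 + p) a 1))) (≤-reflexive (+-comm (ch p a) _))))

  ch-drop′ : ch (suc m) a ≤ 3 * D + ch (suc p) a
  ch-drop′ = subst (λ w → ch (suc w) a ≤ 3 * chm w a 1 + ch (suc p) a) m≡
    (≤-trans (ch-three (suc p) a) (≤-reflexive (+-comm (ch (suc p) a) _)))

  Good : Fam n → Set
  Good G = Unif (2 + a) G × Cross 1 G G

  S-Good : (e z : Fin n) {G : Fam n} → Good G → Good (S e z G)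
  S-Good e z (u , c) = S-Unif e z u , S-Cross e z c

  -- The members avoiding `x` and `y` are sets of size `2 + a` on `suc m` points, where a star on
  -- three points has at most `D` members. Once they exceed this, `kruskal-katona-star` allows no
  -- more members containing both than there are `a`-sets meeting three points.
  link-codegree : {G : Fam (3 + m)} {x y : Fin (3 + m)} → x ≢ y → Good G →
    D < # (G ∩ lacks x ∩ lacks y) → # (G ∩ has x ∩ has y) ≤ 3 * D
  link-codegree {G} x≢y (u , c) large = ≤-trans (≤-reflexive (L.ι-# G true true))
    (+-cancelʳ-≤ (ch (suc p) a) _ _ (≤-trans
      (kruskal-katona-star a (2 + a) 3 (suc p) (G ∘ L.ι true true) (G ∘ L.ι false false)
        (λ v r → suc-injective (suc-injective (trans (sym (L.ι-wt true true v)) (u _ r))))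
        (λ v r → trans (sym (L.ι-wt false false v)) (u _ r))
        (λ v w r s → ≤-trans (c _ _ r s) (≤-reflexive
          (trans (cong wt (L.ι-⋒ true true false false v w)) (L.ι-wt false false (v ⋒ w)))))
        (cong suc m≡) (m≤n⇒m≤1+n a+[2+a]≤m)
        (≤-trans (s≤s (proj₂ D-step)) (≤-trans large (≤-reflexive (L.ι-# G false false)))))
      ch-drop′))
    where
    module L = Link₂ x≢y

  module _ (P Q : Fam m) (b : ℕ) (uP : Unif a P) (uQ : Unif b Q) (c : Cross 1 P Q) (b≤2+a : b ≤ 2 + a) where

    a+b≤m : a + b ≤ m
    a+b≤m = ≤-trans (+-monoʳ-≤ a b≤2+a) a+[2+a]≤m

    -- If `Q` exceeded a star on three points, `P` would be no larger than the family of `a`-sets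
    -- meeting three points.
    3D<⇒ : 3 * D < # P → # Q ≤ chm p b 3
    3D<⇒ large = ≮⇒≥ λ r → <⇒≱ large (+-cancelʳ-≤ (ch p a) _ _
      (≤-trans (kruskal-katona-star a b 3 p P Q uP uQ c m≡ a+b≤m r) ch-drop))

    module _ (small : ∀ y i → 7 * a ≤ y → 3 * chm (suc y) b (3 + i) ≤ ch y a) where

      -- Stars on more and more points are tried until `Q` exceeds the next one. That star bounds
      -- `P`, the previous one bounds `Q`, and `small` compares the two. For `i = a` the star needs
      -- more points than a member of `Q` has, so `Q` is empty.
      climb : ∀ f i y → i + f ≡ a → i + suc y ≡ p → # Q ≤ chm (suc y) b (3 + i) → # P + 3 * # Q ≤ N
      climb zero i y eq eq′ r = ≤-trans
        (≤-reflexive (trans (cong (λ w → # P + 3 * w) Q-empty) (+-identityʳ (# P)))) (Unif-# a P uP)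
        where
        Q-empty : # Q ≡ 0
        Q-empty = n≤0⇒n≡0 (≤-trans r (≤-reflexive (chm-> {suc y} {b} {3 + i}
          (s≤s (≤-trans b≤2+a (≤-reflexive (cong (2 +_) (trans (sym eq) (+-identityʳ i)))))))))
      climb (suc f) i y eq eq′ r with # Q ≤? chm y b (4 + i)
      ... | no r′ = ≤-trans (+-monoʳ-≤ (# P) (≤-trans (*-monoʳ-≤ 3 r) (small y i 7a≤y)))
            (kruskal-katona-star a b (4 + i) y P Q uP uQ c
              (trans (cong (3 +_) (trans (sym (+-suc i y)) eq′)) m≡) a+b≤m (≰⇒> r′))
        where
        7a≤y : 7 * a ≤ y
        7a≤y = +-cancelˡ-≤ i (7 * a) y (≤-trans (+-monoˡ-≤ (7 * a) (≤-trans (m≤m+n i (suc f)) (≤-reflexive eq)))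
          (≤-trans (*-monoˡ-≤ a {8} {36} (m≤m+n 8 28)) (≤-trans (n≤1+n (36 * a))
          (≤-pred (≤-trans p-large (≤-reflexive (trans (sym eq′) (+-suc i y))))))))
      climb (suc f) i zero eq eq′ r | yes _ = ⊥-elim (<⇒≱ i+1<p (≤-reflexive (sym eq′)))
        where
        i+1<p : i + 1 < p
        i+1<p = ≤-trans (s≤s (≤-trans (≤-reflexive (+-comm i 1))
          (s≤s (≤-trans (m≤m+n i (suc f)) (≤-trans (≤-reflexive eq) a≤36a))))) p-large
      climb (suc f) i (suc y) eq eq′ r | yes r′ =
        climb f (suc i) y (trans (sym (+-suc i f)) eq) (trans (sym (+-suc i (suc y))) eq′) r′

      strong-bound : 3 * D < # P → # P + 3 * # Q ≤ N
      strong-bound large = start p refl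
        where
        start : ∀ w → w ≡ p → # P + 3 * # Q ≤ N
        start zero    eq = ⊥-elim (<⇒≱ (s≤s z≤n) (≤-trans p-large (≤-reflexive (sym eq))))
        start (suc y) eq = climb a 0 y refl eq (subst (λ w → # Q ≤ chm w b 3) (sym eq) (3D<⇒ large))

  -- Members of size `2 + a` with a trace of one element on a triple leave links of size `1 + a`,
  -- those with empty trace links of size `2 + a`; hence two versions.
  small₁ : ∀ y i → 7 * a ≤ y → 3 * chm (suc y) (1 + a) (3 + i) ≤ ch y a
  small₁ y i = three-chm y a (suc i)

  small₂ : ∀ y i → 7 * a ≤ y → 3 * chm (suc y) (2 + a) (3 + i) ≤ ch y a
  small₂ y i = three-chm y a i

  module Cells {x y z : Fin (3 + m)} (x≢y : x ≢ y) (x≢z : x ≢ z) (y≢z : y ≢ z) where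

    open Link₃ x≢y x≢z y≢z public

    cell : Fam (3 + m) → Bool → Bool → Bool → Fam (3 + m)
    cell G b c d = G ∩ is b x ∩ is c y ∩ is d z

    link : Fam (3 + m) → Bool → Bool → Bool → Fam m
    link G b c d = cell G b c d ∘ ι b c d

    link-cell-# : ∀ G b c d → # (cell G b c d) ≡ # (link G b c d)
    link-cell-# G b c d = trans (#-cong λ v → idem (G v) (is b x v) (is c y v) (is d z v)) (ι-# (cell G b c d) b c d)
      where
      idem : ∀ p q r s → ((p ∧ q) ∧ r) ∧ s ≡ (((((p ∧ q) ∧ r) ∧ s) ∧ q) ∧ r) ∧ s
      idem true  true  true  true  = refl
      idem true  true  true  false = refl
      idem true  true  false s     = refl
      idem true  false r     s     = refl
      idem false q     r     s     = refl

    cell-⊆ : ∀ G b c d v → cell G b c d v ≡ true → G v ≡ true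
    cell-⊆ G b c d v p = proj₁ (∧-true (proj₁ (∧-true (proj₁ (∧-true p)))))

    link-Unif : ∀ {G} b c d {j} → Unif (bit b + (bit c + (bit d + j))) G → Unif j (link G b c d)
    link-Unif {G} b c d {j} u v p = +-cancelˡ-≡ (bit d) _ _ (+-cancelˡ-≡ (bit c) _ _ (+-cancelˡ-≡ (bit b) _ _
      (trans (sym (ι-wt b c d v)) (u _ (cell-⊆ G b c d (ι b c d v) p)))))

    link-Cross : ∀ {G H} b c d b′ c′ d′ → b ∧ b′ ≡ false → c ∧ c′ ≡ false → d ∧ d′ ≡ false →
      Cross t (cell G b c d) (cell H b′ c′ d′) → Cross t (link G b c d) (link H b′ c′ d′)
    link-Cross b c d b′ c′ d′ i j k cr v w p r = ≤-trans (cr _ _ p r) (≤-reflexive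
      (trans (cong wt (ι-⋒ b c d b′ c′ d′ v w)) (trans (ι-wt (b ∧ b′) (c ∧ c′) (d ∧ d′) (v ⋒ w)) (bits i j k))))
      where
      bits : ∀ {p q r} → p ≡ false → q ≡ false → r ≡ false →
        bit p + (bit q + (bit r + wt (v ⋒ w))) ≡ wt (v ⋒ w)
      bits refl refl refl = refl

    cell-Cross : ∀ {G} b c d b′ c′ d′ → Good G → Cross 1 (cell G b c d) (cell G b′ c′ d′)
    cell-Cross {G} b c d b′ c′ d′ (_ , cr) v w p r = cr v w (cell-⊆ G b c d v p) (cell-⊆ G b′ c′ d′ w r)

    -- The two traces are disjoint, so the links cross-intersect. By `3D<⇒` the second has at most
    -- C(p, a-2) members, which is below `D`.
    star₃ : ∀ {G} → Good G → 3 * D < # (cell G true false true) → # (cell G false true false) ≤ D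
    star₃ {G} g large = ≤-trans (≤-reflexive (link-cell-# G false true false)) (≤-trans
      (3D<⇒ (link G true false true) (link G false true false) (1 + a)
        (link-Unif true false true (proj₁ g)) (link-Unif false true false (proj₁ g))
        (link-Cross true false true false true false refl refl refl (cell-Cross true false true false true false g))
        (n≤1+n (1 + a)) (≤-trans large (≤-reflexive (link-cell-# G true false true))))
      (≤-trans (chm-anti p a 1 (m≤n⇒m≤1+n 2a≤p)) (proj₁ D-step)))

    -- Links of size a+1 with t = 2 give C(m, a-1), which is `D`; in `cross₃-bound` size a+2 with t
    -- = 3 gives the same.
    cross₂-bound : ∀ {G} → Good G → Cross 2 (cell G true false false) (cell G false true false) →
      # (cell G true false false) ≤ D ⊎ # (cell G false true false) ≤ D
    cross₂-bound {G} (u , _) c with Cross-t-bound m (1 + a) (1 + a) 2 2 2 (link G true false false) (link G false true false)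
      (link-Unif true false false u) (link-Unif false true false u)
      (link-Cross true false false false true false refl refl refl c) refl
    ... | inj₁ p = inj₁ (≤-trans (≤-reflexive (link-cell-# G true false false)) p)
    ... | inj₂ p = inj₂ (≤-trans (≤-reflexive (link-cell-# G false true false)) p)

    cross₃-bound : ∀ {G} → Good G → Cross 3 (cell G false false false) (cell G false false false) →
      # (cell G false false false) ≤ D
    cross₃-bound {G} (u , _) c with Cross-t-bound m (2 + a) (2 + a) 3 3 3 (link G false false false) (link G false false false)
      (link-Unif false false false u) (link-Unif false false false u)
      (link-Cross false false false false false false refl refl refl c) refl
    ... | inj₁ p = ≤-trans (≤-reflexive (link-cell-# G false false false)) p
    ... | inj₂ p = ≤-trans (≤-reflexive (link-cell-# G false false false)) p

    cell-strong-bound : ∀ {G} b c d b′ c′ d′ j → Good G →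
      bit b + (bit c + (bit d + a)) ≡ 2 + a → bit b′ + (bit c′ + (bit d′ + j)) ≡ 2 + a →
      b ∧ b′ ≡ false → c ∧ c′ ≡ false → d ∧ d′ ≡ false → j ≤ 2 + a →
      (∀ y i → 7 * a ≤ y → 3 * chm (suc y) j (3 + i) ≤ ch y a) →
      3 * D < # (cell G b c d) → # (cell G b c d) + 3 * # (cell G b′ c′ d′) ≤ N
    cell-strong-bound {G} b c d b′ c′ d′ j g eP eQ i₁ i₂ i₃ j≤ small large =
      subst₂ (λ v w → v + 3 * w ≤ N) (sym (link-cell-# G b c d)) (sym (link-cell-# G b′ c′ d′))
        (strong-bound (link G b c d) (link G b′ c′ d′) j
          (link-Unif b c d (subst (λ w → Unif w G) (sym eP) (proj₁ g)))
          (link-Unif b′ c′ d′ (subst (λ w → Unif w G) (sym eQ) (proj₁ g)))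
          (link-Cross b c d b′ c′ d′ i₁ i₂ i₃ (cell-Cross b c d b′ c′ d′ g))
          j≤ small (≤-trans large (≤-reflexive (link-cell-# G b c d))))

-- Auxiliary elements, splittings and searches

third : (x y : Fin (3 + m)) → ∃ λ e → e ≢ x × e ≢ y
third zero          zero          = suc zero , (λ ()) , (λ ())
third zero          (suc zero)    = suc (suc zero) , (λ ()) , (λ ())
third zero          (suc (suc y)) = suc zero , (λ ()) , (λ ())
third (suc zero)    zero          = suc (suc zero) , (λ ()) , (λ ())
third (suc (suc x)) zero          = suc zero , (λ ()) , (λ ())
third (suc x)       (suc y)       = zero , (λ ()) , (λ ())

others : Fin n → Fin n → List (Fin n)
others {n} x y = filter (λ z → ¬? (z ≟ᶠ x) ×-dec ¬? (z ≟ᶠ y)) (allFin n)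

others⁻ : {x y z : Fin n} → z ∈ others x y → z ≢ x × z ≢ y
others⁻ {x = x} {y} i = proj₂ (∈-filter⁻ (λ z → ¬? (z ≟ᶠ x) ×-dec ¬? (z ≟ᶠ y)) {xs = allFin _} i)

others⁺ : {x y z : Fin n} → z ≢ x → z ≢ y → z ∈ others x y
others⁺ {x = x} {y} {z} p q = ∈-filter⁺ (λ z → ¬? (z ≟ᶠ x) ×-dec ¬? (z ≟ᶠ y)) (∈-allFin z) (p , q)

split-has : (G : Fam n) (x : Fin n) → # G ≤ # (G ∩ has x) + # (G ∩ lacks x)
split-has G x = #-≤2 G (G ∩ has x) (G ∩ lacks x) λ v → bits (G v) (lookup v x)
  where
  bits : ∀ g b → bit g ≤ bit (g ∧ b) + bit (g ∧ not b)
  bits = from-yes (∀𝔹? λ g → ∀𝔹? λ b → bit g ≤? bit (g ∧ b) + bit (g ∧ not b))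

split₃ : (G : Fam n) (x y : Fin n) → # G ≤ # (G ∩ has x) + # (G ∩ has y) + # (G ∩ lacks x ∩ lacks y)
split₃ G x y = #-≤3 G (G ∩ has x) (G ∩ has y) (G ∩ lacks x ∩ lacks y) λ v → bits (G v) (lookup v x) (lookup v y)
  where
  bits : ∀ g e f → bit g ≤ bit (g ∧ e) + bit (g ∧ f) + bit ((g ∧ not e) ∧ not f)
  bits = from-yes (∀𝔹? λ g → ∀𝔹? λ e → ∀𝔹? λ f → bit g ≤? bit (g ∧ e) + bit (g ∧ f) + bit ((g ∧ not e) ∧ not f))

Cross-⊆ : {A B A′ B′ : Fam n} → (∀ v → A′ v ≡ true → A v ≡ true) → (∀ v → B′ v ≡ true → B v ≡ true) →
  Cross t A B → Cross t A′ B′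
Cross-⊆ i j c v w p q = c v w (i v p) (j w q)

true≢ : {x z : Fin n} (v : Vec Bool n) → lookup v x ≡ false → lookup v z ≡ true → x ≢ z
true≢ v p q refl = false≢true (trans (sym p) q)

search : {P : Fin n → Set} → (∀ z → Dec (P z)) → (∃ P → ⊥) → ((∀ z → ¬ P z) → ⊥) → ⊥
search P? found missing with any? P?
... | yes f   = found f
... | no none = missing λ z p → none (z , p)

-- The ground set has size n rather than 3 + m, because sums over Vec Bool (3 + m) unfold.
module Main (m a p : ℕ) (m≡ : 3 + p ≡ m) (p-large : 2 + 36 * a ≤ p)
  (n : ℕ) (n≡ : 3 + m ≡ n) where

  open Large m a p m≡ p-large

  element : Fin n
  element = subst Fin n≡ zero

  another : (x y : Fin n) → ∃ λ e → e ≢ x × e ≢ y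
  another = on n≡
    where
    on : ∀ {n} → 3 + m ≡ n → (x y : Fin n) → ∃ λ e → e ≢ x × e ≢ y
    on refl = third

  codegree : {G : Fam n} {x y : Fin n} → x ≢ y → Good G →
    D < # (G ∩ lacks x ∩ lacks y) → # (G ∩ has x ∩ has y) ≤ 3 * D
  codegree = on n≡
    where
    on : ∀ {n} → 3 + m ≡ n → {G : Fam n} {x y : Fin n} → x ≢ y → Good G →
      D < # (G ∩ lacks x ∩ lacks y) → # (G ∩ has x ∩ has y) ≤ 3 * D
    on refl {G} = link-codegree {G}

  star₃ : {G : Fam n} {x y z : Fin n} → x ≢ y → x ≢ z → y ≢ z → Good G →
    3 * D < # (G ∩ has x ∩ lacks y ∩ has z) → # (G ∩ lacks x ∩ has y ∩ lacks z) ≤ D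
  star₃ = on n≡
    where
    on : ∀ {n} → 3 + m ≡ n → {G : Fam n} {x y z : Fin n} → x ≢ y → x ≢ z → y ≢ z → Good G →
      3 * D < # (G ∩ has x ∩ lacks y ∩ has z) → # (G ∩ lacks x ∩ has y ∩ lacks z) ≤ D
    on refl {G} x≢y x≢z y≢z = Cells.star₃ x≢y x≢z y≢z {G}

  cross₂-bound : {G : Fam n} {x y z : Fin n} → x ≢ y → x ≢ z → y ≢ z → Good G →
    Cross 2 (G ∩ has x ∩ lacks y ∩ lacks z) (G ∩ lacks x ∩ has y ∩ lacks z) →
    # (G ∩ has x ∩ lacks y ∩ lacks z) ≤ D ⊎ # (G ∩ lacks x ∩ has y ∩ lacks z) ≤ D
  cross₂-bound = on n≡
    where
    on : ∀ {n} → 3 + m ≡ n → {G : Fam n} {x y z : Fin n} → x ≢ y → x ≢ z → y ≢ z → Good G →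
      Cross 2 (G ∩ has x ∩ lacks y ∩ lacks z) (G ∩ lacks x ∩ has y ∩ lacks z) →
      # (G ∩ has x ∩ lacks y ∩ lacks z) ≤ D ⊎ # (G ∩ lacks x ∩ has y ∩ lacks z) ≤ D
    on refl {G} x≢y x≢z y≢z = Cells.cross₂-bound x≢y x≢z y≢z {G}

  cross₃-bound : {G : Fam n} {x y z : Fin n} → x ≢ y → x ≢ z → y ≢ z → Good G →
    Cross 3 (G ∩ lacks x ∩ lacks y ∩ lacks z) (G ∩ lacks x ∩ lacks y ∩ lacks z) →
    # (G ∩ lacks x ∩ lacks y ∩ lacks z) ≤ D
  cross₃-bound = on n≡
    where
    on : ∀ {n} → 3 + m ≡ n → {G : Fam n} {x y z : Fin n} → x ≢ y → x ≢ z → y ≢ z → Good G →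
      Cross 3 (G ∩ lacks x ∩ lacks y ∩ lacks z) (G ∩ lacks x ∩ lacks y ∩ lacks z) →
      # (G ∩ lacks x ∩ lacks y ∩ lacks z) ≤ D
    on refl {G} x≢y x≢z y≢z = Cells.cross₃-bound x≢y x≢z y≢z {G}

  -- Pairs of families without elements of high degree

  sum₂ : ∀ c d {u v w} → u ≤ v + w → v ≤ c * D → w ≤ d * D → u ≤ (c + d) * D
  sum₂ c d h i j = ≤-trans h (≤-trans (+-mono-≤ i j) (≤-reflexive (sym (*-distribʳ-+ D c d))))

  sum₃ : ∀ c d e {u v w x} → u ≤ v + w + x → v ≤ c * D → w ≤ d * D → x ≤ e * D → u ≤ (c + d + e) * D
  sum₃ c d e h i j k = sum₂ (c + d) e h (sum₂ c d ≤-refl i j) k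

  sum₄ : ∀ c d e f {u v w x y} → u ≤ v + w + x + y → v ≤ c * D → w ≤ d * D → x ≤ e * D → y ≤ f * D →
    u ≤ (c + d + e + f) * D
  sum₄ c d e f h i j k l = sum₂ (c + d + e) f h (sum₃ c d e ≤-refl i j k) l

  weaken : ∀ c d {u} → c ≤ d → u ≤ c * D → u ≤ d * D
  weaken c d c≤d h = ≤-trans h (*-monoˡ-≤ D c≤d)

  one : ∀ {u} → u ≤ D → u ≤ 1 * D
  one h = ≤-trans h (≤-reflexive (sym (*-identityˡ D)))

  -- The 7 is 3 + 3 + 1: a shift at most doubles the degree bound `3 * D`, and `star₃` allows at
  -- most `D` further sets. Both orders of `x` and `y` are maintained together, since the size of
  -- one family controls the degrees in the other.
  PairBound : (x y : Fin n) → Fam n → Set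
  PairBound x y G = 7 * D < # (G ∩ has x ∩ lacks y) ×
    (∀ z → z ≢ x → z ≢ y → # (G ∩ has x ∩ lacks y ∩ has z) ≤ 3 * D)

  -- Shifting towards e cannot push the degree of e in {F : x ∈ F, y ∉ F} above 3D: the family
  -- {F : y ∈ F, x, e ∉ F} would then have at most D members, contradicting B>7D.
  PairBound-step : ∀ {x y e z} {G : Fam n} → e ≢ x → e ≢ y → x ≢ y → z ≢ x → z ≢ y →
    Good G → PairBound x y G → PairBound y x G → PairBound x y (S e z G)
  PairBound-step {x} {y} {e} {z} {G} e≢x e≢y x≢y z≢x z≢y g (A>7D , A-deg) (B>7D , B-deg) =
    ≤-trans A>7D (≤-reflexive (sym (≗S-# (G ∩ has x ∩ lacks y) shA))) , degrees
    where
    G′ = S e z G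
    shA : ∀ v → (G′ ∩ has x ∩ lacks y) v ≡ S e z (G ∩ has x ∩ lacks y) v
    shA = S-∩₂ e z G (has-Fixes (e≢x ∘ sym) (z≢x ∘ sym)) (lacks-Fixes (e≢y ∘ sym) (z≢y ∘ sym))
    shB : ∀ v → (G′ ∩ has y ∩ lacks x) v ≡ S e z (G ∩ has y ∩ lacks x) v
    shB = S-∩₂ e z G (has-Fixes (e≢y ∘ sym) (z≢y ∘ sym)) (lacks-Fixes (e≢x ∘ sym) (z≢x ∘ sym))
    B-e : # (G′ ∩ has y ∩ lacks x ∩ has e) ≤ 6 * D
    B-e = sum₂ 3 3 (≗S-has-e (G ∩ has y ∩ lacks x) shB) (B-deg e e≢y e≢x) (B-deg z z≢y z≢x)
    B-split : # (G′ ∩ has y ∩ lacks x) ≤ # (G′ ∩ has y ∩ lacks x ∩ has e) + # (G′ ∩ lacks x ∩ has y ∩ lacks e)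
    B-split = #-≤2 (G′ ∩ has y ∩ lacks x) (G′ ∩ has y ∩ lacks x ∩ has e) (G′ ∩ lacks x ∩ has y ∩ lacks e)
      λ v → bits (G′ v) (lookup v x) (lookup v y) (lookup v e)
      where
      bits : ∀ g x y e → bit ((g ∧ y) ∧ not x) ≤ bit (((g ∧ y) ∧ not x) ∧ e) + bit (((g ∧ not x) ∧ y) ∧ not e)
      bits = from-yes (∀𝔹? λ g → ∀𝔹? λ x → ∀𝔹? λ y → ∀𝔹? λ e →
        bit ((g ∧ y) ∧ not x) ≤? bit (((g ∧ y) ∧ not x) ∧ e) + bit (((g ∧ not x) ∧ y) ∧ not e))
    A-e : # (G′ ∩ has x ∩ lacks y ∩ has e) ≤ 3 * D
    A-e = ≮⇒≥ λ big → <⇒≱ B>7D (≤-trans (≤-reflexive (sym (≗S-# (G ∩ has y ∩ lacks x) shB)))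
      (sum₂ 6 1 B-split B-e (one (star₃ {G′} x≢y (e≢x ∘ sym) (e≢y ∘ sym) (S-Good e z g) big))))
    degrees : ∀ w → w ≢ x → w ≢ y → # (G′ ∩ has x ∩ lacks y ∩ has w) ≤ 3 * D
    degrees w w≢x w≢y with w ≟ᶠ e
    ... | yes refl = A-e
    ... | no w≢e   = ≤-trans (≗S-has-≢ (G ∩ has x ∩ lacks y) shA w≢e) (A-deg w w≢x w≢y)

  -- Elements outside the pair are shifted towards a third one, `e`, and both bounds persist. The
  -- parts avoiding `e` are then cross 2-intersecting, so one of them has at most `D` members; with
  -- the degree of `e` this makes `4 * D`, not more than `7 * D`.
  pair-bound : ∀ {x y} {G : Fam n} → x ≢ y → Good G → PairBound x y G → PairBound y x G → ⊥
  pair-bound {x} {y} {G} x≢y g A B = conclude (another x y)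
    where
    Inv : Fam n → Set
    Inv H = Good H × PairBound x y H × PairBound y x H
    conclude : (∃ λ e → e ≢ x × e ≢ y) → ⊥
    conclude (e , e≢x , e≢y) = finish (cross₂-bound {G*} x≢y (e≢x ∘ sym) (e≢y ∘ sym) good* gain)
      where
      zs = others x y
      G* = pull e zs G
      inv : Inv G*
      inv = pull-induction e zs Inv
        (λ {z} i {H} (g , A , B) → let z≢x , z≢y = others⁻ i in
          S-Good e z g ,
          PairBound-step e≢x e≢y x≢y z≢x z≢y g A B ,
          PairBound-step e≢y e≢x (x≢y ∘ sym) z≢y z≢x g B A)
        (g , A , B)
      good* = proj₁ inv
      -- A `z` common to both sets is neither `x` nor `y`, because `w` lacks `x` and `v` lacks `y`;
      -- so the pass included it.
      stable : ∀ v w z → (G* ∩ has x ∩ lacks y) v ≡ true → (G* ∩ lacks x ∩ has y) w ≡ true →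
        lookup v e ≡ false → lookup v z ≡ true → lookup w z ≡ true → (G* ∩ has x ∩ lacks y) (swap e z v) ≡ true
      stable v w z r s i j k = cong₂ _∧_ (cong₂ _∧_
          (pull-Stable e zs G (others⁺ (x≢z ∘ sym) (y≢z ∘ sym)) v (proj₁ (∧-true (proj₁ (∧-true r)))) i j)
          (trans (has-Fixes (e≢x ∘ sym) x≢z v) (proj₂ (∧-true {G* v} (proj₁ (∧-true r))))))
          (trans (lacks-Fixes (e≢y ∘ sym) y≢z v) (proj₂ (∧-true {(G* ∩ has x) v} r)))
        where
        x≢z = true≢ w (not-true (proj₂ (∧-true {G* w} (proj₁ (∧-true s))))) k
        y≢z = true≢ v (not-true (proj₂ (∧-true {(G* ∩ has x) v} r))) j
      gain : Cross 2 (G* ∩ has x ∩ lacks y ∩ lacks e) (G* ∩ lacks x ∩ has y ∩ lacks e)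
      gain = Cross-gain e {G* ∩ has x ∩ lacks y} {G* ∩ lacks x ∩ has y} stable λ v w r s →
        proj₂ good* v w (proj₁ (∧-true (proj₁ (∧-true r)))) (proj₁ (∧-true (proj₁ (∧-true s))))
      contra : ∀ {x y} → e ≢ x → e ≢ y → PairBound x y G* → # (G* ∩ has x ∩ lacks y ∩ lacks e) ≤ D → ⊥
      contra {x} {y} e≢x e≢y (big , deg) small = <⇒≱ big (weaken 4 7 (m≤m+n 4 3)
        (sum₂ 3 1 (split-has (G* ∩ has x ∩ lacks y) e) (deg e e≢x e≢y) (one small)))
      finish : # (G* ∩ has x ∩ lacks y ∩ lacks e) ≤ D ⊎ # (G* ∩ lacks x ∩ has y ∩ lacks e) ≤ D → ⊥
      finish (inj₁ r) = contra e≢x e≢y (proj₁ (proj₂ inv)) r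
      finish (inj₂ r) = contra e≢y e≢x (proj₂ (proj₂ inv)) (≤-trans (≤-reflexive (#-cong λ v →
        cong (_∧ lacks e v) (∧-exchange (G* v) (lookup v y) (lacks x v)))) r)

  -- Each pass raises the intersection number of the sets avoiding x and the target by one.
  two-passes : ∀ {x e f} → x ≢ e → x ≢ f → e ≢ f → (P : Fam n → Set) →
    (∀ {G} → P G → Good G) → (∀ {e z G} → e ≢ x → z ≢ x → P G → P (S e z G)) →
    ∀ {G} → P G → ∃ λ G* → P G* × # (G* ∩ lacks x ∩ lacks e ∩ lacks f) ≤ D
  two-passes {x} {e} {f} x≢e x≢f e≢f P good step {G} h = G₂ , P₂ ,
    cross₃-bound {G₂} x≢e x≢f e≢f (good P₂) (Cross-gain f stable₂ cross₂)
    where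
    -- `others x x` lists all elements except `x`.
    G₁ = pull e (others x x) G
    G₂ = pull f (others x e) G₁
    P₁ : P G₁
    P₁ = pull-induction e (others x x) P (λ i → step (x≢e ∘ sym) (proj₁ (others⁻ i))) h
    P₂ : P G₂
    P₂ = pull-induction f (others x e) P (λ i → step (x≢f ∘ sym) (proj₁ (others⁻ i))) P₁
    stable₁ : ∀ v w z → (G₁ ∩ lacks x) v ≡ true → (G₁ ∩ lacks x) w ≡ true →
      lookup v e ≡ false → lookup v z ≡ true → lookup w z ≡ true → (G₁ ∩ lacks x) (swap e z v) ≡ true
    stable₁ v w z r _ i j _ = cong₂ _∧_
      (pull-Stable e (others x x) G (others⁺ (x≢z ∘ sym) (x≢z ∘ sym)) v (proj₁ (∧-true r)) i j)
      (trans (lacks-Fixes x≢e x≢z v) (proj₂ (∧-true {G₁ v} r)))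
      where
      x≢z = true≢ v (not-true (proj₂ (∧-true {G₁ v} r))) j
    Q : Fam n → Set
    Q H = Cross 2 (H ∩ lacks x ∩ lacks e) (H ∩ lacks x ∩ lacks e)
    cross₁ : Q G₁
    cross₁ = Cross-gain e stable₁ λ v w r s → proj₂ (good P₁) v w (proj₁ (∧-true r)) (proj₁ (∧-true s))
    -- The gain of the first pass survives the second, whose shifts leave `x` and `e` alone and so
    -- act within the sets avoiding both.
    cross₂ : Q G₂
    cross₂ = pull-induction f (others x e) Q (λ {z} i {H} c →
      let z≢x , z≢e = others⁻ i
          sh = S-∩₂ f z H (lacks-Fixes x≢f (z≢x ∘ sym)) (lacks-Fixes e≢f (z≢e ∘ sym))
      in Cross-⊆ (λ v r → trans (sym (sh v)) r) (λ v r → trans (sym (sh v)) r) (S-Cross f z c)) cross₁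
    stable₂ : ∀ v w z → (G₂ ∩ lacks x ∩ lacks e) v ≡ true → (G₂ ∩ lacks x ∩ lacks e) w ≡ true →
      lookup v f ≡ false → lookup v z ≡ true → lookup w z ≡ true → (G₂ ∩ lacks x ∩ lacks e) (swap f z v) ≡ true
    stable₂ v w z r _ i j _ = cong₂ _∧_ (cong₂ _∧_
        (pull-Stable f (others x e) G₁ (others⁺ (x≢z ∘ sym) (e≢z ∘ sym)) v (proj₁ (∧-true (proj₁ (∧-true r)))) i j)
        (trans (lacks-Fixes x≢f x≢z v) (proj₂ (∧-true {G₂ v} (proj₁ (∧-true r))))))
        (trans (lacks-Fixes e≢f e≢z v) (proj₂ (∧-true {(G₂ ∩ lacks x) v} r)))
      where
      x≢z = true≢ v (not-true (proj₂ (∧-true {G₂ v} (proj₁ (∧-true r))))) j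
      e≢z = true≢ v (not-true (proj₂ (∧-true {(G₂ ∩ lacks x) v} r))) j

  -- Popular elements

  gap : ∀ c d e {u v w} → d + e ≤ c → c * D < u → u ≤ v + w → v ≤ d * D → e * D < w
  gap c d e d+e≤c big h i = ≰⇒> λ j → <⇒≱ big (weaken (d + e) c d+e≤c (sum₂ d e h i j))

  codegree′ : ∀ {x y} {G : Fam n} → x ≢ y → Good G →
    1 * D < # (G ∩ lacks x ∩ lacks y) → # (G ∩ has x ∩ has y) ≤ 3 * D
  codegree′ x≢y g h = codegree x≢y g (≤-trans (s≤s (≤-reflexive (sym (*-identityˡ D)))) h)

  pair-from-codegrees : ∀ {x y} {G : Fam n} → 7 * D < # (G ∩ has x ∩ lacks y) →
    (∀ z → z ≢ x → z ≢ y → # (G ∩ has x ∩ has z) ≤ 3 * D) → PairBound x y G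
  pair-from-codegrees {x} {y} {G} big deg = big , λ z z≢x z≢y → ≤-trans
    (#-≤1 {G = G ∩ has x ∩ lacks y ∩ has z} {H = G ∩ has x ∩ has z}
      λ v → bits (G v ∧ lookup v x) (lacks y v) (lookup v z)) (deg z z≢x z≢y)
    where
    bits : ∀ g b c → bit ((g ∧ b) ∧ c) ≤ bit (g ∧ c)
    bits = from-yes (∀𝔹? λ g → ∀𝔹? λ b → ∀𝔹? λ c → bit ((g ∧ b) ∧ c) ≤? bit (g ∧ c))

  lacks-has : (G : Fam n) (x y : Fin n) → # (G ∩ lacks x ∩ has y) ≡ # (G ∩ has y ∩ lacks x)
  lacks-has G x y = #-cong λ v → ∧-exchange (G v) (lacks x v) (lookup v y)

  has-split₃ : (G : Fam n) (x y z : Fin n) →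
    # (G ∩ has x) ≤ # (G ∩ has x ∩ has y) + # (G ∩ has x ∩ has z) + # (G ∩ lacks y ∩ lacks z)
  has-split₃ G x y z = #-≤3 (G ∩ has x) (G ∩ has x ∩ has y) (G ∩ has x ∩ has z) (G ∩ lacks y ∩ lacks z)
    λ v → bits (G v) (lookup v x) (lookup v y) (lookup v z)
    where
    bits : ∀ g x y z → bit (g ∧ x) ≤ bit ((g ∧ x) ∧ y) + bit ((g ∧ x) ∧ z) + bit ((g ∧ not y) ∧ not z)
    bits = from-yes (∀𝔹? λ g → ∀𝔹? λ x → ∀𝔹? λ y → ∀𝔹? λ z →
      bit (g ∧ x) ≤? bit ((g ∧ x) ∧ y) + bit ((g ∧ x) ∧ z) + bit ((g ∧ not y) ∧ not z))

  -- In multiples of `D`: 15 - 14 = 1 counts sets avoiding `x` and any `z`, so codegrees with `x`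
  -- are at most 3. Then 10 - 3 = 7 counts sets containing `x` without `e`, and 10 - 3 - 3 = 4
  -- counts sets avoiding `e` and `z`, which bounds the codegrees with `e`.
  second-popular : ∀ {x e} {G : Fam n} → e ≢ x → Good G → 10 * D < # (G ∩ has x) → 15 * D < # (G ∩ lacks x) →
    (∀ z → z ≢ x → # (G ∩ lacks x ∩ has z) ≤ 14 * D) → 7 * D < # (G ∩ lacks x ∩ has e) → ⊥
  second-popular {x} {e} {G} e≢x g x-big x-small deg e-big = pair-bound (e≢x ∘ sym) g
    (pair-from-codegrees (gap 10 3 7 ≤-refl x-big (split-has (G ∩ has x) e) (cod-x e e≢x)) (λ z z≢x _ → cod-x z z≢x))
    (pair-from-codegrees (≤-trans e-big (≤-reflexive (lacks-has G x e)))
      (λ z z≢e z≢x → codegree′ (z≢e ∘ sym) g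
        (gap 10 6 1 (m≤m+n 7 3) x-big (has-split₃ G x e z) (sum₂ 3 3 ≤-refl (cod-x e e≢x) (cod-x z z≢x)))))
    where
    cod-x : ∀ z → z ≢ x → # (G ∩ has x ∩ has z) ≤ 3 * D
    cod-x z z≢x = codegree′ (z≢x ∘ sym) g (gap 15 14 1 ≤-refl x-small (split-has (G ∩ lacks x) z) (deg z z≢x))

  Codegrees : Fam n → Set
  Codegrees G = ∀ u w → u ≢ w → # (G ∩ has u ∩ has w) ≤ 3 * D

  -- If a second element has degree above `7 * D` among the sets avoiding `x`, `pair-bound` applies
  -- at once. Otherwise shifts keep these degrees at most `7 * D`: a single shift raises them to
  -- `14 * D` at most, and `second-popular` excludes everything above 7.
  popular : ∀ {x} {G : Fam n} → Good G → 10 * D < # (G ∩ has x) → 15 * D < # (G ∩ lacks x) → Codegrees G → ⊥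
  popular {x} {G} g x-big x-small cod =
    search (λ z → ¬? (z ≟ᶠ x) ×-dec (7 * D <? # (G ∩ lacks x ∩ has z))) found missing
    where
    found : (∃ λ z → z ≢ x × 7 * D < # (G ∩ lacks x ∩ has z)) → ⊥
    found (z , z≢x , big) = pair-bound (z≢x ∘ sym) g
      (pair-from-codegrees (gap 10 3 7 ≤-refl x-big (split-has (G ∩ has x) z) (cod x z (z≢x ∘ sym)))
        (λ w w≢x _ → cod x w (w≢x ∘ sym)))
      (pair-from-codegrees (≤-trans big (≤-reflexive (lacks-has G x z))) (λ w w≢z _ → cod z w (w≢z ∘ sym)))
    Inv : Fam n → Set
    Inv H = Good H × 10 * D < # (H ∩ has x) × 15 * D < # (H ∩ lacks x) × (∀ z → z ≢ x → # (H ∩ lacks x ∩ has z) ≤ 7 * D)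
    step : ∀ {e z H} → e ≢ x → z ≢ x → Inv H → Inv (S e z H)
    step {e} {z} {H} e≢x z≢x (g , x-big , x-small , deg) = g′ , x-big′ , x-small′ , deg′
      where
      H′ = S e z H
      g′ = S-Good e z g
      x-big′ : 10 * D < # (H′ ∩ has x)
      x-big′ = ≤-trans x-big (≤-reflexive (sym (S-∩-# e z H (has-Fixes (e≢x ∘ sym) (z≢x ∘ sym)))))
      sh : ∀ v → (H′ ∩ lacks x) v ≡ S e z (H ∩ lacks x) v
      sh = S-∩ e z H (lacks-Fixes (e≢x ∘ sym) (z≢x ∘ sym))
      x-small′ : 15 * D < # (H′ ∩ lacks x)
      x-small′ = ≤-trans x-small (≤-reflexive (sym (≗S-# (H ∩ lacks x) sh)))
      deg-≢ : ∀ w → w ≢ x → w ≢ e → # (H′ ∩ lacks x ∩ has w) ≤ 7 * D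
      deg-≢ w w≢x w≢e = ≤-trans (≗S-has-≢ (H ∩ lacks x) sh w≢e) (deg w w≢x)
      deg-14 : ∀ w → w ≢ x → # (H′ ∩ lacks x ∩ has w) ≤ 14 * D
      deg-14 w w≢x with w ≟ᶠ e
      ... | yes refl = sum₂ 7 7 (≗S-has-e (H ∩ lacks x) sh) (deg e e≢x) (deg z z≢x)
      ... | no w≢e   = weaken 7 14 (m≤m+n 7 7) (deg-≢ w w≢x w≢e)
      deg′ : ∀ w → w ≢ x → # (H′ ∩ lacks x ∩ has w) ≤ 7 * D
      deg′ w w≢x with w ≟ᶠ e
      ... | yes refl = ≮⇒≥ λ big → second-popular e≢x g′ x-big′ x-small′ deg-14 big
      ... | no w≢e   = deg-≢ w w≢x w≢e
    covered : ∀ {e f} → e ≢ x → f ≢ x → (∃ λ H → Inv H × # (H ∩ lacks x ∩ lacks e ∩ lacks f) ≤ D) → ⊥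
    -- All but `D` of the sets avoiding `x` contain `e` or `f`, and 7 + 7 + 1 = 15.
    covered {e} {f} e≢x f≢x (H , (_ , _ , x-small , deg) , small) =
      <⇒≱ x-small (sum₃ 7 7 1 (split₃ (H ∩ lacks x) e f) (deg e e≢x) (deg f f≢x) (one small))
    missing : (∀ z → ¬ (z ≢ x × 7 * D < # (G ∩ lacks x ∩ has z))) → ⊥
    missing none =
      let e , e≢x , _   = another x x
          f , f≢x , f≢e = another x e
      in covered e≢x f≢x (two-passes (e≢x ∘ sym) (f≢x ∘ sym) (f≢e ∘ sym) Inv proj₁ step
           (g , x-big , x-small , λ z z≢x → ≮⇒≥ λ big → none z (z≢x , big)))

  -- While no degree exceeds `10 * D`, one shift raises a single degree to `20 * D` at most. Any two
  -- degrees then sum to at most `30 * D`, which leaves more than `D` sets avoiding both elements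
  -- and so renews the codegree bound. If the raised degree exceeds `10 * D`, then 35 - 20 = 15
  -- meets the hypotheses of `popular`.
  some-codegree-large : {G : Fam n} → Good G → 35 * D < # G → (∀ x → 15 * D < # (G ∩ lacks x)) → Codegrees G → ⊥
  some-codegree-large {G} g G-big x-small cod = search (λ x → 10 * D <? # (G ∩ has x))
    (λ (x , x-big) → popular g x-big (x-small x) cod) missing
    where
    Inv : Fam n → Set
    Inv H = Good H × 35 * D < # H × (∀ z → # (H ∩ has z) ≤ 10 * D)
    step : ∀ {e z H} → Inv H → Inv (S e z H)
    step {e} {z} {H} (g , H-big , deg) = g′ , H-big′ , deg′
      where
      H′ = S e z H
      g′ = S-Good e z g
      H-big′ : 35 * D < # H′
      H-big′ = ≤-trans H-big (≤-reflexive (sym (S-# e z H)))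
      deg-≢ : ∀ w → w ≢ e → # (H′ ∩ has w) ≤ 10 * D
      deg-≢ w w≢e = ≤-trans (S-has-≢ e z H w≢e) (deg w)
      deg-e : # (H′ ∩ has e) ≤ 20 * D
      deg-e = sum₂ 10 10 (S-has-e e z H) (deg e) (deg z)
      two-degrees : ∀ u w → u ≢ w → # (H′ ∩ has u) + # (H′ ∩ has w) ≤ 30 * D
      two-degrees u w u≢w with u ≟ᶠ e
      ... | yes refl = sum₂ 20 10 ≤-refl deg-e (deg-≢ w (u≢w ∘ sym))
      ... | no u≢e with w ≟ᶠ e
      ...   | yes refl = sum₂ 10 20 ≤-refl (deg-≢ u u≢e) deg-e
      ...   | no w≢e   = weaken 20 30 (m≤m+n 20 10) (sum₂ 10 10 ≤-refl (deg-≢ u u≢e) (deg-≢ w w≢e))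
      cod′ : Codegrees H′
      cod′ u w u≢w = codegree′ u≢w g′ (gap 35 30 1 (m≤m+n 31 4) H-big′ (split₃ H′ u w) (two-degrees u w u≢w))
      deg′ : ∀ w → # (H′ ∩ has w) ≤ 10 * D
      deg′ w with w ≟ᶠ e
      ... | yes refl = ≮⇒≥ λ big → popular g′ big (gap 35 20 15 ≤-refl H-big′ (split-has H′ e) deg-e) cod′
      ... | no w≢e   = deg-≢ w w≢e
    covered : ∀ {x e f} → (∃ λ H → Inv H × # (H ∩ lacks x ∩ lacks e ∩ lacks f) ≤ D) → ⊥
    -- After two passes 10 + 10 + 10 + 1 = 31 bounds the whole family.
    covered {x} {e} {f} (H , (_ , H-big , deg) , small) = <⇒≱ H-big (weaken 31 35 (m≤m+n 31 4)
      (sum₄ 10 10 10 1 cover (deg x) (deg e) (deg f) (one small)))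
      where
      cover : # H ≤ # (H ∩ has x) + # (H ∩ has e) + # (H ∩ has f) + # (H ∩ lacks x ∩ lacks e ∩ lacks f)
      cover = #-≤4 H (H ∩ has x) (H ∩ has e) (H ∩ has f) (H ∩ lacks x ∩ lacks e ∩ lacks f)
        λ v → bits (H v) (lookup v x) (lookup v e) (lookup v f)
        where
        bits : ∀ g d e f → bit g ≤ bit (g ∧ d) + bit (g ∧ e) + bit (g ∧ f) + bit (((g ∧ not d) ∧ not e) ∧ not f)
        bits = from-yes (∀𝔹? λ g → ∀𝔹? λ d → ∀𝔹? λ e → ∀𝔹? λ f →
          bit g ≤? bit (g ∧ d) + bit (g ∧ e) + bit (g ∧ f) + bit (((g ∧ not d) ∧ not e) ∧ not f))
    missing : (∀ z → ¬ (10 * D < # (G ∩ has z))) → ⊥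
    missing none =
      let x             = element
          e , e≢x , _   = another x x
          f , f≢x , f≢e = another x e
      in covered (two-passes (e≢x ∘ sym) (f≢x ∘ sym) (f≢e ∘ sym) Inv proj₁ (λ _ _ → step)
           (g , G-big , λ z → ≮⇒≥ (none z)))

  -- Families concentrated on a triple

  cell-strong-bound : {G : Fam n} {x y z : Fin n} → x ≢ y → x ≢ z → y ≢ z → Good G → ∀ b c d b′ c′ d′ j →
    bit b + (bit c + (bit d + a)) ≡ 2 + a → bit b′ + (bit c′ + (bit d′ + j)) ≡ 2 + a →
    b ∧ b′ ≡ false → c ∧ c′ ≡ false → d ∧ d′ ≡ false → j ≤ 2 + a →
    (∀ y i → 7 * a ≤ y → 3 * chm (suc y) j (3 + i) ≤ ch y a) →
    3 * D < # (G ∩ is b x ∩ is c y ∩ is d z) →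
    # (G ∩ is b x ∩ is c y ∩ is d z) + 3 * # (G ∩ is b′ x ∩ is c′ y ∩ is d′ z) ≤ N
  cell-strong-bound = on n≡
    where
    on : ∀ {n} → 3 + m ≡ n → {G : Fam n} {x y z : Fin n} → x ≢ y → x ≢ z → y ≢ z → Good G → ∀ b c d b′ c′ d′ j →
      bit b + (bit c + (bit d + a)) ≡ 2 + a → bit b′ + (bit c′ + (bit d′ + j)) ≡ 2 + a →
      b ∧ b′ ≡ false → c ∧ c′ ≡ false → d ∧ d′ ≡ false → j ≤ 2 + a →
      (∀ y i → 7 * a ≤ y → 3 * chm (suc y) j (3 + i) ≤ ch y a) →
      3 * D < # (G ∩ is b x ∩ is c y ∩ is d z) →
      # (G ∩ is b x ∩ is c y ∩ is d z) + 3 * # (G ∩ is b′ x ∩ is c′ y ∩ is d′ z) ≤ N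
    on refl {G} x≢y x≢z y≢z g b c d b′ c′ d′ j = Cells.cell-strong-bound x≢y x≢z y≢z {G} b c d b′ c′ d′ j g

  exchange₂ : (G c d e : Fam n) → # (G ∩ c ∩ d ∩ e) ≡ # (G ∩ d ∩ c ∩ e)
  exchange₂ G c d e = #-cong λ v → cong (_∧ e v) (∧-exchange (G v) (c v) (d v))

  -- One large trace of size two spreads to the others: `star₃` makes `f₂` small, so the sets
  -- avoiding `x` lie mostly in `p₁`; then `f₁` is small as well, so those avoiding `z` lie mostly
  -- in `p₃`. With all three large, `strong` holds for each of them.
  triangle : ∀ {F : Fam n} {x y z} → x ≢ y → x ≢ z → y ≢ z → Good F → (∀ u → N < # (F ∩ lacks u)) →
    # (F ∩ lacks x ∩ lacks y) ≤ D → 3 * D < # (F ∩ has x ∩ lacks y ∩ has z) → ⊥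
  triangle {F} {x} {y} {z} x≢y x≢z y≢z g div few p-xz =
    balance N p₁ p₂ p₃ f₁ f₂ f₃ f₀
      (≤-trans (div x) (#-≤4 (F ∩ lacks x) (cell false true true) (cell false true false) (cell false false true) (cell false false false)
        λ v → cover-x (F v) (lookup v x) (lookup v y) (lookup v z)))
      (≤-trans (div y) (#-≤4 (F ∩ lacks y) (cell true false true) (cell true false false) (cell false false true) (cell false false false)
        λ v → cover-y (F v) (lookup v x) (lookup v y) (lookup v z)))
      (≤-trans (div z) (#-≤4 (F ∩ lacks z) (cell true true false) (cell true false false) (cell false true false) (cell false false false)
        λ v → cover-z (F v) (lookup v x) (lookup v y) (lookup v z)))
      (strong false true true true false false (1 + a) refl refl refl refl refl (n≤1+n (1 + a)) small₁ p-yz)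
      (strong true false true false true false (1 + a) refl refl refl refl refl (n≤1+n (1 + a)) small₁ p-xz)
      (strong true true false false false true (1 + a) refl refl refl refl refl (n≤1+n (1 + a)) small₁ p-xy)
      (strong false true true false false false (2 + a) refl refl refl refl refl ≤-refl small₂ p-yz)
      (strong true false true false false false (2 + a) refl refl refl refl refl ≤-refl small₂ p-xz)
      (strong true true false false false false (2 + a) refl refl refl refl refl ≤-refl small₂ p-xy)
    where
    cell : Bool → Bool → Bool → Fam n
    cell b c d = F ∩ is b x ∩ is c y ∩ is d z
    p₁ = # (cell false true true)
    p₂ = # (cell true false true)
    p₃ = # (cell true true false)
    f₁ = # (cell true false false)
    f₂ = # (cell false true false)
    f₃ = # (cell false false true)
    f₀ = # (cell false false false)
    strong = cell-strong-bound {F} x≢y x≢z y≢z g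
    cover-x : ∀ g x y z → bit (g ∧ not x) ≤ bit (((g ∧ not x) ∧ y) ∧ z) + bit (((g ∧ not x) ∧ y) ∧ not z)
      + bit (((g ∧ not x) ∧ not y) ∧ z) + bit (((g ∧ not x) ∧ not y) ∧ not z)
    cover-x = from-yes (∀𝔹? λ g → ∀𝔹? λ x → ∀𝔹? λ y → ∀𝔹? λ z → bit (g ∧ not x) ≤?
      bit (((g ∧ not x) ∧ y) ∧ z) + bit (((g ∧ not x) ∧ y) ∧ not z)
      + bit (((g ∧ not x) ∧ not y) ∧ z) + bit (((g ∧ not x) ∧ not y) ∧ not z))
    cover-y : ∀ g x y z → bit (g ∧ not y) ≤ bit (((g ∧ x) ∧ not y) ∧ z) + bit (((g ∧ x) ∧ not y) ∧ not z)
      + bit (((g ∧ not x) ∧ not y) ∧ z) + bit (((g ∧ not x) ∧ not y) ∧ not z)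
    cover-y = from-yes (∀𝔹? λ g → ∀𝔹? λ x → ∀𝔹? λ y → ∀𝔹? λ z → bit (g ∧ not y) ≤?
      bit (((g ∧ x) ∧ not y) ∧ z) + bit (((g ∧ x) ∧ not y) ∧ not z)
      + bit (((g ∧ not x) ∧ not y) ∧ z) + bit (((g ∧ not x) ∧ not y) ∧ not z))
    cover-z : ∀ g x y z → bit (g ∧ not z) ≤ bit (((g ∧ x) ∧ y) ∧ not z) + bit (((g ∧ x) ∧ not y) ∧ not z)
      + bit (((g ∧ not x) ∧ y) ∧ not z) + bit (((g ∧ not x) ∧ not y) ∧ not z)
    cover-z = from-yes (∀𝔹? λ g → ∀𝔹? λ x → ∀𝔹? λ y → ∀𝔹? λ z → bit (g ∧ not z) ≤?
      bit (((g ∧ x) ∧ y) ∧ not z) + bit (((g ∧ x) ∧ not y) ∧ not z)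
      + bit (((g ∧ not x) ∧ y) ∧ not z) + bit (((g ∧ not x) ∧ not y) ∧ not z))
    f₂≤D : f₂ ≤ D
    f₂≤D = star₃ {F} x≢y x≢z y≢z g p-xz
    35D< : ∀ u → 35 * D < # (F ∩ lacks u)
    35D< u = ≤-trans (s≤s 35D≤N) (div u)
    f₀+f₃≤D : f₃ + f₀ ≤ D
    f₀+f₃≤D = ≤-trans (≤-reflexive (trans (sym (∑-+ (bit ∘ cell false false true) (bit ∘ cell false false false)))
      (∑-cong λ v → bits ((F v ∧ lacks x v) ∧ lacks y v) (lookup v z)))) few
      where
      bits : ∀ g b → bit (g ∧ b) + bit (g ∧ not b) ≡ bit g
      bits = from-yes (∀𝔹? λ g → ∀𝔹? λ b → (bit (g ∧ b) + bit (g ∧ not b)) ≟ bit g)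
    p-yz : 3 * D < p₁
    p-yz = gap 35 2 3 (m≤m+n 5 30) (35D< x)
      (≤-trans (#-≤4 (F ∩ lacks x) (cell false true true) (cell false true false) (cell false false true) (cell false false false)
        λ v → cover-x (F v) (lookup v x) (lookup v y) (lookup v z)) (≤-reflexive (regroup p₁ f₂ f₃ f₀)))
      (sum₂ 1 1 ≤-refl (one f₂≤D) (one f₀+f₃≤D))
      where
      regroup : ∀ p q r s → p + q + r + s ≡ q + (r + s) + p
      regroup = solve-∀
    f₁≤D : f₁ ≤ D
    f₁≤D = ≤-trans (≤-reflexive (exchange₂ F (has x) (lacks y) (lacks z)))
      (star₃ {F} (x≢y ∘ sym) y≢z x≢z g (≤-trans p-yz (≤-reflexive (exchange₂ F (lacks x) (has y) (has z)))))
    p-xy : 3 * D < p₃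
    p-xy = gap 35 3 3 (m≤m+n 6 29) (35D< z)
      (≤-trans (#-≤4 (F ∩ lacks z) (cell true true false) (cell true false false) (cell false true false) (cell false false false)
        λ v → cover-z (F v) (lookup v x) (lookup v y) (lookup v z)) (≤-reflexive (regroup p₃ f₁ f₂ f₀)))
      (sum₃ 1 1 1 ≤-refl (one f₁≤D) (one f₂≤D) (one (≤-trans (m≤n+m f₀ f₃) f₀+f₃≤D)))
      where
      regroup : ∀ p q r s → p + q + r + s ≡ (q + r + s) + p
      regroup = solve-∀
    balance : ∀ N p₁ p₂ p₃ f₁ f₂ f₃ f₀ →
      N < p₁ + f₂ + f₃ + f₀ → N < p₂ + f₁ + f₃ + f₀ → N < p₃ + f₁ + f₂ + f₀ →
      p₁ + 3 * f₁ ≤ N → p₂ + 3 * f₂ ≤ N → p₃ + 3 * f₃ ≤ N →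
      p₁ + 3 * f₀ ≤ N → p₂ + 3 * f₀ ≤ N → p₃ + 3 * f₀ ≤ N → ⊥
    -- The lower bounds are taken three times, the bounds with `f₁`, `f₂`, `f₃` twice and those with
    -- `3 * f₀` once. The totals on the two sides agree, so `9 * (1 + N)` would be at most `9 * N`.
    balance N p₁ p₂ p₃ f₁ f₂ f₃ f₀ h₁ h₂ h₃ g₁ g₂ g₃ k₁ k₂ k₃ = <⇒≱ (≤-reflexive (strict N))
      (≤-trans (≤-trans (m≤n+m _ 8) (≤-reflexive (nine N))) (≤-trans (*-monoʳ-≤ 3 (+-mono-≤ (+-mono-≤ h₁ h₂) h₃))
      (≤-trans (≤-reflexive (identity p₁ p₂ p₃ f₁ f₂ f₃ f₀))
      (+-mono-≤ (*-monoʳ-≤ 2 (+-mono-≤ (+-mono-≤ g₁ g₂) g₃)) (+-mono-≤ (+-mono-≤ k₁ k₂) k₃)))))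
      where
      strict : ∀ N → suc (2 * (N + N + N) + (N + N + N)) ≡ 1 + 9 * N
      strict = solve-∀
      nine : ∀ N → 8 + (1 + 9 * N) ≡ 3 * ((1 + N) + (1 + N) + (1 + N))
      nine = solve-∀
      identity : ∀ p₁ p₂ p₃ f₁ f₂ f₃ f₀ →
        3 * ((p₁ + f₂ + f₃ + f₀) + (p₂ + f₁ + f₃ + f₀) + (p₃ + f₁ + f₂ + f₀)) ≡
        2 * ((p₁ + 3 * f₁) + (p₂ + 3 * f₂) + (p₃ + 3 * f₃)) + ((p₁ + 3 * f₀) + (p₂ + 3 * f₀) + (p₃ + 3 * f₀))
      identity = solve-∀

  diversity-bound : ∀ {F : Fam n} → Good F → (∀ u → N < # (F ∩ lacks u)) → ⊥
  diversity-bound {F} g div =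
    search (λ x → any? λ y → ¬? (x ≟ᶠ y) ×-dec (3 * D <? # (F ∩ has x ∩ has y))) found missing
    where
    35D< : ∀ u → 35 * D < # (F ∩ lacks u)
    35D< u = ≤-trans (s≤s 35D≤N) (div u)
    missing : (∀ x → ¬ ∃ λ y → x ≢ y × 3 * D < # (F ∩ has x ∩ has y)) → ⊥
    missing none = some-codegree-large g
      (≤-trans (35D< element) (#-≤1 {G = F ∩ lacks element} {H = F} λ v → bits (F v) (lacks element v)))
      (λ x → ≤-trans (s≤s (*-monoˡ-≤ D (m≤m+n 15 20))) (35D< x))
      (λ u w u≢w → ≮⇒≥ λ big → none u (w , u≢w , big))
      where
      bits : ∀ b c → bit (b ∧ c) ≤ bit b
      bits = from-yes (∀𝔹? λ b → ∀𝔹? λ c → bit (b ∧ c) ≤? bit b)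
    found : (∃ λ x → ∃ λ y → x ≢ y × 3 * D < # (F ∩ has x ∩ has y)) → ⊥
    found (x , y , x≢y , big) =
      search (λ z → ¬? (z ≟ᶠ x) ×-dec (¬? (z ≟ᶠ y) ×-dec
        ((3 * D <? # (F ∩ has x ∩ lacks y ∩ has z)) ⊎-dec (3 * D <? # (F ∩ has y ∩ lacks x ∩ has z))))) close apart
      where
      few : # (F ∩ lacks x ∩ lacks y) ≤ D
      few = ≮⇒≥ λ h → <⇒≱ big (codegree x≢y g h)
      few′ : # (F ∩ lacks y ∩ lacks x) ≤ D
      few′ = ≤-trans (≤-reflexive (#-cong λ v → ∧-exchange (F v) (lacks y v) (lacks x v))) few
      close : (∃ λ z → z ≢ x × z ≢ y × (3 * D < # (F ∩ has x ∩ lacks y ∩ has z) ⊎ 3 * D < # (F ∩ has y ∩ lacks x ∩ has z))) → ⊥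
      close (z , z≢x , z≢y , inj₁ h) = triangle x≢y (z≢x ∘ sym) (z≢y ∘ sym) g div few h
      close (z , z≢x , z≢y , inj₂ h) = triangle (x≢y ∘ sym) (z≢y ∘ sym) (z≢x ∘ sym) g div few′ h
      apart : (∀ z → ¬ (z ≢ x × z ≢ y × (3 * D < # (F ∩ has x ∩ lacks y ∩ has z) ⊎ 3 * D < # (F ∩ has y ∩ lacks x ∩ has z)))) → ⊥
      -- Without such a `z` no third element has high degree on either side of the pair. Both sides
      -- are large, because of more than `35 * D` sets avoiding one of `x`, `y` at most `D` avoid
      -- the other.
      apart none = pair-bound x≢y g
        (one-sided y x few′ , λ z z≢x z≢y → ≮⇒≥ λ h → none z (z≢x , z≢y , inj₁ h))
        (one-sided x y few , λ z z≢y z≢x → ≮⇒≥ λ h → none z (z≢x , z≢y , inj₂ h))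
        where
        one-sided : ∀ x y → # (F ∩ lacks x ∩ lacks y) ≤ D → 7 * D < # (F ∩ has y ∩ lacks x)
        one-sided x y few = ≤-trans (gap 35 1 7 (m≤m+n 8 27) (35D< x)
          (≤-trans (split-has (F ∩ lacks x) y) (≤-reflexive (+-comm (# (F ∩ lacks x ∩ has y)) _))) (one few))
          (≤-reflexive (lacks-has F x y))

-- From lists of sets to Boolean functions

remove : Fam n → Vec Bool n → Fam n
remove H []          []          = false
remove H (true  ∷ x) (true  ∷ v) = remove (H ∘ (true ∷_)) x v
remove H (true  ∷ x) (false ∷ v) = H (false ∷ v)
remove H (false ∷ x) (true  ∷ v) = H (true ∷ v)
remove H (false ∷ x) (false ∷ v) = remove (H ∘ (false ∷_)) x v

#-remove : (H : Fam n) (x : Vec Bool n) → H x ≡ true → suc (# (remove H x)) ≡ # H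
#-remove H []          p rewrite p = refl
#-remove H (true  ∷ x) p = cong (_+ # (H ∘ (false ∷_))) (#-remove (H ∘ (true ∷_)) x p)
#-remove H (false ∷ x) p = trans (sym (+-suc (# (H ∘ (true ∷_))) _)) (cong (# (H ∘ (true ∷_)) +_) (#-remove (H ∘ (false ∷_)) x p))

remove-≢ : (H : Fam n) (x v : Vec Bool n) → x ≢ v → H v ≡ true → remove H x v ≡ true
remove-≢ H []          []          x≢v p = ⊥-elim (x≢v refl)
remove-≢ H (true  ∷ x) (true  ∷ v) x≢v p = remove-≢ (H ∘ (true ∷_)) x v (x≢v ∘ cong (true ∷_)) p
remove-≢ H (true  ∷ x) (false ∷ v) x≢v p = p
remove-≢ H (false ∷ x) (true  ∷ v) x≢v p = p
remove-≢ H (false ∷ x) (false ∷ v) x≢v p = remove-≢ (H ∘ (false ∷_)) x v (x≢v ∘ cong (false ∷_)) p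

-- Each entry is charged to a member of `H` that is then deleted; uniqueness keeps the later entries
-- inside what remains.
length≤# : (xs : List (Vec Bool n)) (H : Fam n) → Unique xs → All (λ v → H v ≡ true) xs → length xs ≤ # H
length≤# []       H _           _          = z≤n
length≤# (x ∷ xs) H (x∉ ∷ uniq) (Hx ∷ Hxs) = ≤-trans
  (s≤s (length≤# xs (remove H x) uniq (All.zipWith (λ {v} (x≢v , Hv) → remove-≢ H x v x≢v Hv) (x∉ , Hxs))))
  (≤-reflexive (#-remove H x Hx))

∣∣≡wt : (A : Vec Bool n) → ∣ A ∣ ≡ wt A
∣∣≡wt []          = refl
∣∣≡wt (true  ∷ A) = cong suc (∣∣≡wt A)
∣∣≡wt (false ∷ A) = ∣∣≡wt A

wt-∋ : (v : Vec Bool n) (z : Fin n) → lookup v z ≡ true → 1 ≤ wt v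
wt-∋ (true  ∷ v) zero    p = s≤s z≤n
wt-∋ (b     ∷ v) (suc z) p = ≤-trans (wt-∋ v z p) (m≤n+m (wt v) (bit b))

minList-≤ : ∀ {x} xs → x ∈ xs → minList xs ≤ x
minList-≤ (y ∷ ys) i = bound ys i
  where
  bound : ∀ {x} ys → x ∈ (y ∷ ys) → foldr _⊓_ y ys ≤ x
  bound []       (here refl)         = ≤-refl
  bound (z ∷ zs) (here refl)         = ≤-trans (m⊓n≤n z _) (bound zs (here refl))
  bound (z ∷ zs) (there (here refl)) = m⊓n≤m z _
  bound (z ∷ zs) (there (there i))   = ≤-trans (m⊓n≤n z _) (bound zs (there i))

diversity-≤ : (F : Family n) (i : Fin n) → diversity F ≤ avoidCount F i
diversity-≤ F i = minList-≤ _ (∈-map⁺ (avoidCount F) (∈-toList⁺ (∈-allFin⁺ i)))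

module Indicator (F : Family n) where

  _∈ₛ?_ : (v : Vec Bool n) (xs : List (Vec Bool n)) → Dec (v ∈ xs)
  _∈ₛ?_ = DecMembership._∈?_ (≡-dec _≟ᵇ_)

  indicator : Fam n
  indicator v = ⌊ v ∈ₛ? sets F ⌋

  indicator⁺ : ∀ {v} → v ∈ sets F → indicator v ≡ true
  indicator⁺ {v} i with v ∈ₛ? sets F
  ... | yes _ = refl
  ... | no ∉  = ⊥-elim (∉ i)

  indicator⁻ : ∀ v → indicator v ≡ true → v ∈ sets F
  indicator⁻ v p with v ∈ₛ? sets F
  ... | yes i = i

  indicator-Unif : Uniform k F → Unif k indicator
  indicator-Unif u v p = trans (sym (∣∣≡wt v)) (All.lookup u (indicator⁻ v p))

  indicator-Cross : Intersecting F → Cross 1 indicator indicator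
  indicator-Cross c v w p q with c (indicator⁻ v p) (indicator⁻ w q)
  ... | z , i = wt-∋ (v ⋒ w) z ([]=⇒lookup i)

  avoidCount≤# : ∀ i → avoidCount F i ≤ # (indicator ∩ lacks i)
  avoidCount≤# i = length≤# _ (indicator ∩ lacks i) (filter⁺ avoids? (unique F)) (All.tabulate member)
    where
    avoids? = λ (A : Vec Bool n) → ¬? (i ∈ᵥ? A)
    member : ∀ {v} → v ∈ filter avoids? (sets F) → (indicator ∩ lacks i) v ≡ true
    member {v} j with ∈-filter⁻ avoids? {xs = sets F} j
    ... | j′ , i∉v = cong₂ _∧_ (indicator⁺ j′) (outside (lookup v i) refl)
      where
      outside : ∀ b → lookup v i ≡ b → not b ≡ true
      outside true  e = ⊥-elim (i∉v (lookup⇒[]= i v e))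
      outside false e = refl

-- Singletons and the theorem

singletons : {G : Fam n} → Fin n → Unif 1 G → Cross 1 G G → (∀ u → 0 < # (G ∩ lacks u)) → ⊥
singletons {n = n} {G} i u c div = conclude (member i)
  where
  member : ∀ x → ∃ λ v → (G ∩ lacks x) v ≡ true
  member x with #-member (G ∩ lacks x)
  ... | inj₁ e = ⊥-elim (<⇒≱ (div x) (≤-reflexive e))
  ... | inj₂ h = h
  conclude : (∃ λ v → (G ∩ lacks i) v ≡ true) → ⊥
  -- The member `v` consists of `x` alone, while some member `w` avoids `x`. As `v` and `w` meet,
  -- adding `x` to `w` would give two common elements, too many for `v`.
  conclude (v , p) with wt-pos v (≤-reflexive (sym (u v (proj₁ (∧-true p)))))
  ... | x , v-x with member x
  ... | w , r = <⇒≱ (s≤s (c v w Gv (proj₁ (∧-true r)))) (≤-trans (≤-reflexive one-more)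
          (≤-trans (wt-⋒ˡ v (w [ x ]≔ true)) (≤-reflexive (u v Gv))))
    where
    Gv = proj₁ (∧-true p)
    one-more : suc (wt (v ⋒ w)) ≡ wt (v ⋒ (w [ x ]≔ true))
    one-more = bits v-x (not-true (proj₂ (∧-true {G w} r))) (wt-⋒-≔ x true v w)
      where
      bits : ∀ {b c X Y} → b ≡ true → c ≡ false → bit (b ∧ c) + X ≡ bit (b ∧ true) + Y → suc Y ≡ X
      bits refl refl eq = sym eq

theorem1p6 : (n k : ℕ) → 1 ≤ k → 36 * k < n → (F : Family n) →
    Uniform k F → Intersecting F →
    diversity F ≤ binomPred (n ∸ 3) (k ∸ 1)
-- For `k = 1` the bound is `binomPred _ 0`, which is 0, and `large` supplies an element of the
-- ground set.
theorem1p6 n (suc zero) _ large F u c = ≮⇒≥ λ div →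
  singletons (fromℕ< large) (indicator-Unif u) (indicator-Cross c)
    λ i → ≤-trans div (≤-trans (diversity-≤ F i) (avoidCount≤# i))
  where open Indicator F
theorem1p6 n (suc (suc a)) _ large F u c = ≮⇒≥ λ div →
  Main.diversity-bound (3 + p) a p refl p-large n n≡ (indicator-Unif u , indicator-Cross c)
    λ i → ≤-trans (s≤s (≤-reflexive N≡)) (≤-trans div (≤-trans (diversity-≤ F i) (avoidCount≤# i)))
  where
  open Indicator F
  -- Six elements are set aside: the three that carry the traces and the three of a star. With k = a
  -- + 2, `large` reads 36a + 73 ≤ n, which leaves ample room for `p-large`.
  p = n ∸ 6
  regroup : ∀ a → 66 + (6 + (36 * a + 1)) ≡ 1 + 36 * (2 + a)
  regroup = solve-∀
  bound : 66 + (6 + (36 * a + 1)) ≤ n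
  bound = ≤-trans (≤-reflexive (regroup a)) large
  n≡ : 6 + p ≡ n
  n≡ = m+[n∸m]≡n (≤-trans (m≤m+n 6 _) (≤-trans (m≤n+m _ 66) bound))
  p-large : 2 + 36 * a ≤ p
  p-large = +-cancelˡ-≤ 6 _ _ (≤-trans (≤-trans (≤-reflexive (small a)) (m≤n+m _ 65)) (≤-trans bound (≤-reflexive (sym n≡))))
    where
    small : ∀ a → 6 + (2 + 36 * a) ≡ 1 + (6 + (36 * a + 1))
    small = solve-∀
  N≡ : ch (3 + p) a ≡ (n ∸ 3) C a
  N≡ = trans (ch≡C (3 + p) a) (cong (λ w → (w ∸ 3) C a) n≡)
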